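{- For every integer $n\geq 0$, \[ \overline{p}(5n)\equiv (-1)^{n}\,\overline{p}(20n) \pmod{5}. \]
   Context: An overpartition of a nonnegative integer $n$ is a partition of $n$ (a nonincreasing sequence of positive integers summing to $n$) in which the first occurrence of each distinct part may be overlined. $\overline{p}(n)$ denotes the number of overpartitions of $n$, with $\overline{p}(0)=1$ and $\overline{p}(n)=0$ for $n<0$. Equivalently, $\sum_{n\ge0}\overline{p}(n)q^n=\prod_{k\ge1}\frac{1+q^k}{1-q^k}$. -}

module Defs where

open import Data.Bool using (Bool; true; false)
open import Data.Bool.Properties using () renaming (_≟_ to _≟ᵇ_)
open import Data.Integer as ℤ using (ℤ)
import Data.Integer.Divisibility as ℤ
open import Data.List using (List; []; _∷_; map; sum; length; filter; upTo; cartesianProduct; cartesianProductWith)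
open import Data.List.Membership.Propositional using (_∈_)
open import Data.List.Membership.Propositional.Properties
  using (∈-filter⁺; ∈-filter⁻; ∈-map⁺; ∈-upTo⁺; ∈-cartesianProduct⁺; ∈-cartesianProductWith⁺; ∈-cartesianProductWith⁻)
open import Data.List.Properties using (∷-injective)
open import Data.List.Relation.Unary.All using (All; []; _∷_; all?)
import Data.List.Relation.Unary.All as All
open import Data.List.Relation.Unary.AllPairs using ([]; _∷_)
open import Data.List.Relation.Unary.Any using (here; there)
open import Data.List.Relation.Unary.Linked using (Linked; linked?)
open import Data.List.Relation.Unary.Unique.Propositional using (Unique)
open import Data.List.Relation.Unary.Unique.Propositional.Properties
  using (map⁺; upTo⁺; filter⁺; cartesianProduct⁺; cartesianProductWith⁺)
open import Data.Nat using (ℕ; zero; suc; _+_; _≤_; _>_; _≤?_; _>?_; _≟_; z≤n; s≤s)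
open import Data.Nat.Properties using (suc-injective; ≤-refl; ≤-trans; m≤m+n; m≤n+m; +-mono-≤)
open import Data.Product using (_×_; _,_; proj₁; proj₂)
open import Function using (_∘_; _⇔_; mk⇔)
open import Relation.Binary.PropositionalEquality using (_≡_; _≢_; refl; sym; subst)
open import Relation.Nullary using (Dec; ¬?)
open import Relation.Nullary.Decidable using (_×-dec_; _→-dec_)

-- A part together with a flag telling whether it is overlined.
Part : Set
Part = ℕ × Bool

size : Part → ℕ
size = proj₁

Overlined : Part → Set
Overlined (_ , o) = o ≡ true

-- The relation between consecutive parts.  In a nonincreasing sequence equal
-- parts are adjacent, so a part is the first occurrence of its size exactly
-- when it differs from its immediate predecessor (or has none).
_⊵_ : Part → Part → Set
p ⊵ q = (size q ≤ size p) × (Overlined q → size p ≢ size q)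

IsOverpartition : ℕ → List Part → Set
IsOverpartition n ps = All (λ p → size p > 0) ps × Linked _⊵_ ps × sum (map size ps) ≡ n

overlined? : ∀ p → Dec (Overlined p)
overlined? (_ , o) = o ≟ᵇ true

_⊵?_ : ∀ p q → Dec (p ⊵ q)
p ⊵? q = (size q ≤? size p) ×-dec (overlined? q →-dec ¬? (size p ≟ size q))

isOverpartition? : ∀ n ps → Dec (IsOverpartition n ps)
isOverpartition? n ps =
  all? (λ p → size p >? 0) ps ×-dec linked? _⊵?_ ps ×-dec (sum (map size ps) ≟ n)

partsUpTo : ℕ → List Part
partsUpTo n = cartesianProduct (map suc (upTo n)) (true ∷ false ∷ [])

-- All lists of length at most l with entries taken from as.
listsUpTo : {A : Set} → List A → ℕ → List (List A)
listsUpTo as zero    = [] ∷ []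
listsUpTo as (suc l) = [] ∷ cartesianProductWith _∷_ as (listsUpTo as l)

-- An overpartition of n has at most n parts, each of size at most n, so
-- filtering these finitely many candidates loses nothing; see
-- ∈-overpartitions and overpartitions-unique.
overpartitions : ℕ → List (List Part)
overpartitions n = filter (isOverpartition? n) (listsUpTo (partsUpTo n) n)

p̅ : ℕ → ℕ
p̅ n = length (overpartitions n)

infix 4 _≡_[mod_]

_≡_[mod_] : ℤ → ℤ → ℤ → Set
a ≡ b [mod m ] = m ℤ.∣ a ℤ.- b

private
  ∈-partsUpTo : ∀ {n} (p : Part) → size p > 0 → size p ≤ n → p ∈ partsUpTo n
  ∈-partsUpTo (suc k , o) _ k<n = ∈-cartesianProduct⁺ (∈-map⁺ suc (∈-upTo⁺ k<n)) (∈-bools o)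
    where
    ∈-bools : ∀ o → o ∈ true ∷ false ∷ []
    ∈-bools true  = here refl
    ∈-bools false = there (here refl)

  ∈-listsUpTo : ∀ {A : Set} {as : List A} {xs} l → All (_∈ as) xs → length xs ≤ l → xs ∈ listsUpTo as l
  ∈-listsUpTo zero    []         _         = here refl
  ∈-listsUpTo (suc l) []         _         = here refl
  ∈-listsUpTo (suc l) (x∈ ∷ xs∈) (s≤s len) =
    there (∈-cartesianProductWith⁺ _∷_ x∈ (∈-listsUpTo l xs∈ len))

  listsUpTo-unique : ∀ {A : Set} {as : List A} → Unique as → ∀ l → Unique (listsUpTo as l)
  listsUpTo-unique         u zero    = [] ∷ []
  listsUpTo-unique {as = as} u (suc l) =
    All.tabulate nonempty ∷ cartesianProductWith⁺ _∷_ ∷-injective u (listsUpTo-unique u l)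
    where
    nonempty : ∀ {ys} → ys ∈ cartesianProductWith _∷_ as (listsUpTo as l) → [] ≢ ys
    nonempty ys∈ refl with ∈-cartesianProductWith⁻ _∷_ as (listsUpTo as l) ys∈
    ... | _ , _ , _ , _ , ()

  partsUpTo-unique : ∀ n → Unique (partsUpTo n)
  partsUpTo-unique n =
    cartesianProduct⁺ (map⁺ suc-injective (upTo⁺ n)) (((λ ()) ∷ []) ∷ [] ∷ [])

  length≤sum : ∀ {ps : List Part} → All (λ p → size p > 0) ps → length ps ≤ sum (map size ps)
  length≤sum []       = z≤n
  length≤sum (p ∷ ps) = +-mono-≤ p (length≤sum ps)

  parts≤sum : ∀ (ps : List Part) → All (λ p → size p ≤ sum (map size ps)) ps
  parts≤sum []       = []
  parts≤sum (p ∷ ps) =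
    m≤m+n (size p) _ ∷ All.map (λ le → ≤-trans le (m≤n+m _ (size p))) (parts≤sum ps)

∈-overpartitions : ∀ n ps → ps ∈ overpartitions n ⇔ IsOverpartition n ps
∈-overpartitions n ps = mk⇔ (proj₂ ∘ ∈-filter⁻ (isOverpartition? n) {xs = listsUpTo (partsUpTo n) n}) complete
  where
  complete : IsOverpartition n ps → ps ∈ overpartitions n
  complete isO@(pos , _ , refl) = ∈-filter⁺ (isOverpartition? n)
    (∈-listsUpTo n (All.zipWith (λ { {p} (p>0 , p≤n) → ∈-partsUpTo p p>0 p≤n }) (pos , parts≤sum ps))
      (length≤sum pos))
    isO

overpartitions-unique : ∀ n → Unique (overpartitions n)
overpartitions-unique n = filter⁺ (isOverpartition? n) (listsUpTo-unique (partsUpTo-unique n) n)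

_ : map p̅ (upTo 5) ≡ 1 ∷ 2 ∷ 4 ∷ 8 ∷ 14 ∷ []
_ = refl

{-# OPTIONS --safe #-}

-- Let θ = Σ q^(k²) over all integers k.  A telescoping of Shanks proves Gauss's
-- formula P(q) θ(−q) = 1 for the generating function P of the overpartitions,
-- that is P(−q) θ(q) = 1.  Let U extract the coefficients at multiples of 5.
-- Modulo 5, θ(q)⁵ = θ(q⁵), hence θ(q⁵) P(−q) = θ⁴ and θ · U(P(−q)) = U(θ⁴).
-- Splitting θ by residues of exponents, θ = θ(q²⁵) + q θ₁(q⁵) + q⁴ θ₄(q⁵), gives
-- U(θ⁴) = (θ(q⁵)² + q θ₁ θ₄)² mod 5, and multiplication by 2 + i on the Gaussian
-- integers shows θ² = θ(q⁵)² + q θ₁ θ₄.  So U(θ⁴) = θ⁴ and U(P(−q)) = θ³, that is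
-- (−1)ⁿ p̅(5n) = r₃(n) mod 5.  Since a sum of three squares divisible by 4 has only
-- even terms, r₃(4n) = r₃(n), and the congruence follows.

module Submission where

open import Defs
open import Algebra.Bundles using (CommutativeRing)
import Algebra.Properties.Ring
import Algebra.Solver.Ring
open import Algebra.Solver.Ring.AlmostCommutativeRing using (fromCommutativeRing; _-Raw-AlmostCommutative⟶_)
open import Algebra.Structures using (IsCommutativeRing)
open import Data.Bool using (true; false)
open import Data.Empty using (⊥-elim)
open import Data.Fin using (Fin; toℕ; fromℕ<)
open import Data.Fin.Properties using (all?; toℕ-fromℕ<)
open import Data.Integer as ℤ using (ℤ; +_; -[1+_]; 0ℤ; 1ℤ; -1ℤ; ∣_∣)
open import Data.Integer.Divisibility.Signed as ℤ∣ using () renaming (_∣_ to _∣ℤ_)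
import Data.Integer.Properties as ℤ
import Data.Integer.Solver as ℤS
open import Data.List using (List; []; _∷_; map; length; filter; _++_; cartesianProduct)
open import Data.List.Membership.Propositional using (_∈_)
open import Data.List.Membership.Propositional.Properties
  using (∈-filter⁺; ∈-filter⁻; ∈-map⁺; ∈-map⁻; ∈-++⁺ˡ; ∈-++⁺ʳ; ∈-++⁻; ∈-cartesianProduct⁺; ∈-cartesianProduct⁻)
open import Data.List.Membership.Propositional.Properties.WithK using (unique∧set⇒bag)
open import Data.List.Properties using (length-++; length-map; filter-all; filter-accept; filter-reject; ∷-injectiveʳ)
open import Data.List.Relation.Binary.BagAndSetEquality using (∼bag⇒↭)
open import Data.List.Relation.Binary.Permutation.Propositional.Properties using (↭-length)
open import Data.List.Relation.Unary.All as All using ([]; _∷_)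
open import Data.List.Relation.Unary.AllPairs using ([]; _∷_)
open import Data.List.Relation.Unary.Any using (here; there)
open import Data.List.Relation.Unary.Linked using ([]; [-]; _∷_)
open import Data.List.Relation.Unary.Unique.Propositional using (Unique)
open import Data.List.Relation.Unary.Unique.Propositional.Properties using (map⁺; ++⁺; filter⁺; cartesianProduct⁺)
open import Data.Maybe using (Maybe; just; nothing)
open import Data.Nat as ℕ using (ℕ; zero; suc; _<_; _≤_; z≤n; s≤s; _≤?_)
open import Data.Nat.DivMod using ([m+kn]%n≡m%n; m<n⇒m%n≡m; m*n%n≡0; m%n<n; %-distribˡ-+; %-distribˡ-*)
open import Data.Nat.Divisibility as ℕ∣ using () renaming (_∣_ to _∣ℕ_)
open import Data.Nat.Primality using (euclidsLemma; prime?)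
import Data.Nat.Properties as ℕ
import Data.Nat.Solver as ℕS
open import Data.Product using (∃; ∃₂; _×_; _,_; proj₁; proj₂; swap)
open import Data.Sum as Sum using (inj₁; inj₂; _⊎_)
open import Data.Unit using (⊤; tt)
open import Function using (_∘_; mk⇔; Equivalence)
open import Level using (0ℓ)
open import Relation.Binary.PropositionalEquality as ≡ using (_≡_; _≢_)
open import Relation.Nullary using (yes; no; ¬_; ¬?)
open import Relation.Nullary.Decidable using (from-yes)
open import Relation.Unary using (Pred; Decidable)

-- Formal power series

-- No infinite product or limit of series is ever formed. Gauss's formula comes from finite
-- identities: with Pₖ counting the overpartitions into parts at most k and Aₖ the part of θ(-q)
-- over |j| ≤ k, the product Pₖ Aₖ agrees with 1 up to q^k, and up to there Pₖ and Aₖ already have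
-- their final coefficients. Division by 1 - q^(k+1) is avoided too: the quotient of Pₖ counts
-- explicit lists, and the factor is cancelled because w = h + q^(k+1) w has only one solution.
-- Behind the formula for θ² stands 5 = (2 + i)(2 - i). If x² + y² = 5n, then x and y are both
-- divisible by 5, or the two squares are 1 and 4 mod 5 in some order and exactly one of 2 + i, 2 -
-- i divides x + iy. Multiplication by 2 + i reaches the pairs divisible by 2 + i; exchanging x and
-- y exchanges the two divisors. Swapping the image pairs whose squares come in the order 4, 1
-- therefore yields all pairs with squares 1, 4, each once. This turns r₂(n) into a count of pairs
-- of norm 5n sorted by residues, which is what the right side of the formula counts.

module _ {a} {A : Set a} where

  -- spread z k c f lists the coefficients of q^c f(q^(k+1)), with z for the missing ones.
  spread : A → (k c : ℕ) → (ℕ → A) → ℕ → A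
  spread z k zero    f zero    = f 0
  spread z k zero    f (suc n) = spread z k k (f ∘ suc) n
  spread z k (suc c) f zero    = z
  spread z k (suc c) f (suc n) = spread z k c f n

  delay : A → ℕ → (ℕ → A) → ℕ → A
  delay z zero    f n       = f n
  delay z (suc c) f zero    = z
  delay z (suc c) f (suc n) = delay z c f n

  -- As in spread, the modulus is k + 1.
  section : (k r : ℕ) → (ℕ → A) → ℕ → A
  section k r f n = f (n ℕ.* suc k ℕ.+ r)

module _ {a} {A : Set a} (z : A) where

  delay-high : ∀ c f j → delay z c f (c ℕ.+ j) ≡ f j
  delay-high zero    f j = ≡.refl
  delay-high (suc c) f j = delay-high c f j

  delay-low : ∀ c f {i} → i < c → delay z c f i ≡ z
  delay-low (suc c) f {zero}  _         = ≡.refl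
  delay-low (suc c) f {suc i} (s≤s i<c) = delay-low c f i<c

module _ {a b} {A : Set a} {B : Set b} (h : A → B) (z : A) where

  -- The same shifts act on coefficients and on families of lists; naturality in `h` turns a shifted
  -- enumeration into a shifted generating function.
  spread-map : ∀ k c f n → h (spread z k c f n) ≡ spread (h z) k c (h ∘ f) n
  spread-map k zero    f zero    = ≡.refl
  spread-map k zero    f (suc n) = spread-map k k (f ∘ suc) n
  spread-map k (suc c) f zero    = ≡.refl
  spread-map k (suc c) f (suc n) = spread-map k c f n

  delay-map : ∀ c f n → h (delay z c f n) ≡ delay (h z) c (h ∘ f) n
  delay-map zero    f n       = ≡.refl
  delay-map (suc c) f zero    = ≡.refl
  delay-map (suc c) f (suc n) = delay-map c f n

module PowerSeries {c ℓ} (R : CommutativeRing c ℓ) where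

  open CommutativeRing R renaming (Carrier to K)
  open import Algebra.Properties.Ring ring using (-‿distribʳ-*; -0#≈0#)
  open import Algebra.Properties.AbelianGroup +-abelianGroup using (⁻¹-∙-comm)
  open import Algebra.Properties.CommutativeSemigroup +-commutativeSemigroup
    using (interchange; x∙yz≈y∙xz)
  open import Relation.Binary.Reasoning.Setoid setoid

  Series : Set c
  Series = ℕ → K

  infix 4 _≋_

  record _≋_ (f g : Series) : Set ℓ where
    constructor coeffs
    field coeff : ∀ n → f n ≈ g n

  open _≋_ public

  infixl 6 _⊕_
  infixl 7 _⊛_
  infix  8 ⊖_

  -- Opaque, so that unification sees f ⊕ g and not the pointwise sum.
  opaque
    _⊕_ : Series → Series → Series
    (f ⊕ g) n = f n + g n

    ⊖_ : Series → Series
    (⊖ f) n = - f n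

    ⊕-coeff : ∀ f g n → (f ⊕ g) n ≈ f n + g n
    ⊕-coeff f g n = refl

    ⊖-coeff : ∀ f n → (⊖ f) n ≈ - f n
    ⊖-coeff f n = refl

  const : K → Series
  const a zero    = a
  const a (suc _) = 0#

  -- Write f = f₀ + q f′; then f g = f₀ g + q f′ g.
  _⊛_ : Series → Series → Series
  (f ⊛ g) zero    = f 0 * g 0
  (f ⊛ g) (suc n) = f 0 * g (suc n) + ((f ∘ suc) ⊛ g) n

  ↑ : Series → Series
  ↑ f zero    = 0#
  ↑ f (suc n) = f n

  infix 4 _≐[_]_

  _≐[_]_ : Series → ℕ → Series → Set ℓ
  f ≐[ N ] g = ∀ {n} → n < N → f n ≈ g n

  private
    ≐-tail : ∀ {N f g} → f ≐[ suc N ] g → f ∘ suc ≐[ N ] g ∘ suc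
    ≐-tail f≐g n<N = f≐g (s≤s n<N)

    ≐-weaken : ∀ {N f g} → f ≐[ suc N ] g → f ≐[ N ] g
    ≐-weaken f≐g n<N = f≐g (ℕ.m≤n⇒m≤1+n n<N)

  -- Coefficient n of a product involves only coefficients up to n of the factors. This is what lets
  -- a truncation stand for its limit below q^N.
  ⊛-cong-upTo : ∀ {N f f′ g g′} → f ≐[ N ] f′ → g ≐[ N ] g′ → f ⊛ g ≐[ N ] f′ ⊛ g′
  ⊛-cong-upTo {suc N} f≐ g≐ {zero} _ = *-cong (f≐ (s≤s z≤n)) (g≐ (s≤s z≤n))
  ⊛-cong-upTo {suc N} f≐ g≐ {suc n} (s≤s n<N) =
    +-cong (*-cong (f≐ (s≤s z≤n)) (g≐ (s≤s n<N)))
           (⊛-cong-upTo {N} (≐-tail f≐) (≐-weaken g≐) n<N)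

  ⊛-cong : ∀ {f f′ g g′} → f ≋ f′ → g ≋ g′ → f ⊛ g ≋ f′ ⊛ g′
  ⊛-cong f≋ g≋ .coeff n =
    ⊛-cong-upTo {suc n} (λ {i} _ → f≋ .coeff i) (λ {i} _ → g≋ .coeff i) ℕ.≤-refl

  private opaque
    unfolding _⊕_

    ⊛-distribʳ : ∀ h f g n → ((f ⊕ g) ⊛ h) n ≈ (f ⊛ h) n + (g ⊛ h) n
    ⊛-distribʳ h f g zero    = distribʳ _ _ _
    ⊛-distribʳ h f g (suc n) =
      trans (+-cong (distribʳ _ _ _) (⊛-distribʳ h (f ∘ suc) (g ∘ suc) n)) (interchange _ _ _ _)

    ⊛-zeroˡ : ∀ f n → ((λ _ → 0#) ⊛ f) n ≈ 0#
    ⊛-zeroˡ f zero    = zeroˡ _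
    ⊛-zeroˡ f (suc n) = trans (+-cong (zeroˡ _) (⊛-zeroˡ f n)) (+-identityˡ 0#)

    const-⊛ : ∀ a f n → (const a ⊛ f) n ≈ a * f n
    const-⊛ a f zero    = refl
    const-⊛ a f (suc n) = trans (+-congˡ (⊛-zeroˡ f n)) (+-identityʳ _)

    scale-⊛ : ∀ a f g n → ((λ i → a * f i) ⊛ g) n ≈ a * (f ⊛ g) n
    scale-⊛ a f g zero    = *-assoc _ _ _
    scale-⊛ a f g (suc n) =
      trans (+-cong (*-assoc _ _ _) (scale-⊛ a (f ∘ suc) g n)) (sym (distribˡ _ _ _))

    ⊛-assoc : ∀ f g h n → ((f ⊛ g) ⊛ h) n ≈ (f ⊛ (g ⊛ h)) n
    ⊛-assoc f g h zero    = *-assoc _ _ _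
    ⊛-assoc f g h (suc n) = begin
      f 0 * g 0 * h (suc n) + (((λ i → f 0 * g (suc i)) ⊕ ((f ∘ suc) ⊛ g)) ⊛ h) n
        ≈⟨ +-cong (*-assoc _ _ _) (⊛-distribʳ h _ _ n) ⟩
      f 0 * (g 0 * h (suc n)) + (((λ i → f 0 * g (suc i)) ⊛ h) n + (((f ∘ suc) ⊛ g) ⊛ h) n)
        ≈⟨ +-congˡ (+-cong (scale-⊛ (f 0) (g ∘ suc) h n) (⊛-assoc (f ∘ suc) g h n)) ⟩
      f 0 * (g 0 * h (suc n)) + (f 0 * ((g ∘ suc) ⊛ h) n + ((f ∘ suc) ⊛ (g ⊛ h)) n)
        ≈⟨ +-assoc _ _ _ ⟨
      f 0 * (g 0 * h (suc n)) + f 0 * ((g ∘ suc) ⊛ h) n + ((f ∘ suc) ⊛ (g ⊛ h)) n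
        ≈⟨ +-congʳ (distribˡ _ _ _) ⟨
      f 0 * (g ⊛ h) (suc n) + ((f ∘ suc) ⊛ (g ⊛ h)) n ∎

    ⊛-sucʳ : ∀ f g n → (f ⊛ g) (suc n) ≈ f (suc n) * g 0 + (f ⊛ (g ∘ suc)) n
    ⊛-sucʳ f g zero    = +-comm _ _
    ⊛-sucʳ f g (suc n) = trans (+-congˡ (⊛-sucʳ (f ∘ suc) g n)) (x∙yz≈y∙xz _ _ _)

    ⊛-comm : ∀ f g n → (f ⊛ g) n ≈ (g ⊛ f) n
    ⊛-comm f g zero    = *-comm _ _
    ⊛-comm f g (suc n) = trans (+-cong (*-comm _ _) (⊛-comm (f ∘ suc) g n)) (sym (⊛-sucʳ g f n))

    ⊛-distribˡ : ∀ h f g n → (h ⊛ (f ⊕ g)) n ≈ (h ⊛ f) n + (h ⊛ g) n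
    ⊛-distribˡ h f g n =
      trans (⊛-comm h _ n) (trans (⊛-distribʳ h f g n) (+-cong (⊛-comm f h n) (⊛-comm g h n)))

    ⊛-identityˡ : ∀ f n → (const 1# ⊛ f) n ≈ f n
    ⊛-identityˡ f n = trans (const-⊛ 1# f n) (*-identityˡ _)

  opaque
    unfolding _⊕_

    series-isCommutativeRing : IsCommutativeRing _≋_ _⊕_ _⊛_ ⊖_ (const 0#) (const 1#)
    series-isCommutativeRing = record
      { isRing = record
        { +-isAbelianGroup = record
          { isGroup = record
            { isMonoid = record
              { isSemigroup = record
                { isMagma = record
                  { isEquivalence = record
                    { refl = coeffs λ _ → refl
                    ; sym = λ e → coeffs λ n → sym (e .coeff n)
                    ; trans = λ d e → coeffs λ n → trans (d .coeff n) (e .coeff n)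
                    }
                  ; ∙-cong = λ d e → coeffs λ n → +-cong (d .coeff n) (e .coeff n)
                  }
                ; assoc = λ f g h → coeffs λ n → +-assoc (f n) (g n) (h n)
                }
              ; identity =
                  (λ f → coeffs λ { zero → +-identityˡ _ ; (suc _) → +-identityˡ _ }) ,
                  (λ f → coeffs λ { zero → +-identityʳ _ ; (suc _) → +-identityʳ _ })
              }
            ; inverse =
                (λ f → coeffs λ { zero → -‿inverseˡ _ ; (suc _) → -‿inverseˡ _ }) ,
                (λ f → coeffs λ { zero → -‿inverseʳ _ ; (suc _) → -‿inverseʳ _ })
            ; ⁻¹-cong = λ e → coeffs λ n → -‿cong (e .coeff n)
            }
          ; comm = λ f g → coeffs λ n → +-comm (f n) (g n)
          }
        ; *-cong = ⊛-cong
        ; *-assoc = λ f g h → coeffs (⊛-assoc f g h)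
        ; *-identity =
            (λ f → coeffs (⊛-identityˡ f)) ,
            (λ f → coeffs λ n → trans (⊛-comm f _ n) (⊛-identityˡ f n))
        ; distrib =
            (λ h f g → coeffs (⊛-distribˡ h f g)) ,
            (λ h f g → coeffs (⊛-distribʳ h f g))
        }
      ; *-comm = λ f g → coeffs (⊛-comm f g)
      }

  series-commutativeRing : CommutativeRing c ℓ
  series-commutativeRing = record
    { Carrier = Series
    ; _≈_ = _≋_
    ; _+_ = _⊕_
    ; _*_ = _⊛_
    ; -_ = ⊖_
    ; 0# = const 0#
    ; 1# = const 1#
    ; isCommutativeRing = series-isCommutativeRing
    }

  private
    module S = CommutativeRing series-commutativeRing
    module Sᵖ = Algebra.Properties.Ring S.ring

  X : Series
  X = ↑ (const 1#)

  ↑-⊛ : ∀ f g → ↑ f ⊛ g ≋ ↑ (f ⊛ g)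
  ↑-⊛ f g .coeff zero    = zeroˡ _
  ↑-⊛ f g .coeff (suc n) = trans (+-congʳ (zeroˡ _)) (+-identityˡ _)

  ↑-cong : ∀ {f g} → f ≋ g → ↑ f ≋ ↑ g
  ↑-cong f≋g .coeff zero    = refl
  ↑-cong f≋g .coeff (suc n) = f≋g .coeff n

  ⊛-↑ : ∀ f g → f ⊛ ↑ g ≋ ↑ (f ⊛ g)
  ⊛-↑ f g = S.trans (S.*-comm f (↑ g)) (S.trans (↑-⊛ g f) (↑-cong (S.*-comm g f)))

  ↑≋X⊛ : ∀ f → ↑ f ≋ X ⊛ f
  ↑≋X⊛ f = S.sym (S.trans (↑-⊛ (const 1#) f) (↑-cong (S.*-identityˡ f)))

  opaque
    unfolding _⊕_

    head-tail : ∀ f → f ≋ const (f 0) ⊕ ↑ (f ∘ suc)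
    head-tail f .coeff zero    = sym (+-identityʳ _)
    head-tail f .coeff (suc n) = sym (+-identityˡ _)

  const-cong : ∀ {a b} → a ≈ b → const a ≋ const b
  const-cong a≈b .coeff zero    = a≈b
  const-cong a≈b .coeff (suc n) = refl

  opaque
    unfolding _⊕_

    const-+ : ∀ a b → const (a + b) ≋ const a ⊕ const b
    const-+ a b .coeff zero    = refl
    const-+ a b .coeff (suc n) = sym (+-identityˡ 0#)

  const-* : ∀ a b → const (a * b) ≋ const a ⊛ const b
  const-* a b .coeff n = sym (trans (const-⊛ a (const b) n) (scale n))
    where
    scale : ∀ n → a * const b n ≈ const (a * b) n
    scale zero    = refl
    scale (suc _) = zeroʳ a

  opaque
    unfolding _⊕_

    const-neg : ∀ a → const (- a) ≋ ⊖ const a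
    const-neg a .coeff zero    = refl
    const-neg a .coeff (suc n) = sym -0#≈0#

  -- A linear fixed-point equation whose recursive occurrence carries a factor q
  -- has at most one solution.
  opaque
    unfolding _⊕_

    ≋-coinduction : ∀ {i} {I : Set i} (w : Series) (u v : I → Series) →
      (∀ i → ∃ λ h → ∃ λ j → u i ≋ h ⊕ ↑ (w ⊛ u j) × v i ≋ h ⊕ ↑ (w ⊛ v j)) →
      ∀ i → u i ≋ v i
    ≋-coinduction w u v step i .coeff n = agree (suc n) i ℕ.≤-refl
      where
      ↑-upTo : ∀ {N f g} → f ≐[ N ] g → ↑ f ≐[ suc N ] ↑ g
      ↑-upTo f≐g {zero}  _         = refl
      ↑-upTo f≐g {suc n} (s≤s n<N) = f≐g n<N

      agree : ∀ N i → u i ≐[ N ] v i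
      -- The factor q raises agreement below q^N to agreement below q^(N+1).
      agree (suc N) i {n} n<N with step i
      ... | h , j , u≋ , v≋ = begin
        u i n                  ≈⟨ u≋ .coeff n ⟩
        h n + ↑ (w ⊛ u j) n    ≈⟨ +-congˡ (↑-upTo (⊛-cong-upTo (λ _ → refl) (agree N j)) n<N) ⟩
        h n + ↑ (w ⊛ v j) n    ≈⟨ v≋ .coeff n ⟨
        v i n                  ∎

  open import Algebra.Properties.Semiring.Exp S.semiring using (_^_)

  X^-⊛-low : ∀ c f {n} → n < c → (X ^ c ⊛ f) n ≈ 0#
  X^-⊛-low (suc c) f {n} n<c = trans (S.trans (S.*-assoc X (X ^ c) f) (S.sym (↑≋X⊛ _)) .coeff n) (low n n<c)
    where
    low : ∀ n → n < suc c → ↑ (X ^ c ⊛ f) n ≈ 0#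
    low zero    _         = refl
    low (suc n) (s≤s n<c) = X^-⊛-low c f n<c

  delay-suc : ∀ c f → delay 0# (suc c) f ≋ ↑ (delay 0# c f)
  delay-suc c f .coeff zero    = refl
  delay-suc c f .coeff (suc n) = refl

  delay≋X^⊛ : ∀ c f → delay 0# c f ≋ X ^ c ⊛ f
  delay≋X^⊛ zero    f = S.sym (S.*-identityˡ f)
  delay≋X^⊛ (suc c) f = S.trans (delay-suc c f) (S.trans (↑-cong (delay≋X^⊛ c f))
    (S.trans (↑≋X⊛ _) (S.sym (S.*-assoc X (X ^ c) f))))

  -- The substitution q ↦ q^(k+1).
  dilate : ℕ → Series → Series
  dilate k = spread 0# k 0

  spread-suc : ∀ k c f → spread 0# k (suc c) f ≋ ↑ (spread 0# k c f)
  spread-suc k c f .coeff zero    = refl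
  spread-suc k c f .coeff (suc n) = refl

  -- The shape that `≋-coinduction` asks for: from q^(k+1) one factor q is split off as `↑`, and
  -- `X ^ k` remains as the weight.
  dilate-unfold : ∀ k f → dilate k f ≋ const (f 0) ⊕ ↑ (X ^ k ⊛ dilate k (f ∘ suc))
  dilate-unfold k f =
    S.trans (head-tail (dilate k f)) (S.+-congˡ (↑-cong (monomial-⊛ k)))
    where
    monomial-⊛ : ∀ c → spread 0# k c (f ∘ suc) ≋ X ^ c ⊛ dilate k (f ∘ suc)
    monomial-⊛ zero    = S.sym (S.*-identityˡ _)
    monomial-⊛ (suc c) = S.trans (spread-suc k c (f ∘ suc)) (S.trans (↑-cong (monomial-⊛ c))
      (S.trans (↑≋X⊛ _) (S.sym (S.*-assoc X (X ^ c) _))))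

  private
    spread-⊛ : ∀ k c f g → spread 0# k c f ⊛ g ≋ dilate k f ⊛ delay 0# c g
    spread-⊛ k zero    f g = S.refl
    spread-⊛ k (suc c) f g =
      S.trans (S.*-congʳ (spread-suc k c f)) (S.trans (↑-⊛ (spread 0# k c f) g)
        (S.trans (↑-cong (spread-⊛ k c f g)) (S.trans (S.sym (⊛-↑ (dilate k f) (delay 0# c g)))
          (S.*-congˡ (S.sym (delay-suc c g))))))

    spread-⊛-low : ∀ k c f g {i} → i < c → (spread 0# k c f ⊛ g) i ≈ 0#
    spread-⊛-low k (suc c) f g {zero}  _         = zeroˡ _
    spread-⊛-low k (suc c) f g {suc i} (s≤s i<c) =
      trans (+-cong (zeroˡ _) (spread-⊛-low k c f g i<c)) (+-identityˡ 0#)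

    spread-⊛-high : ∀ k c f g j → (spread 0# k c f ⊛ g) (c ℕ.+ j) ≈ (dilate k f ⊛ g) j
    spread-⊛-high k zero    f g j = refl
    spread-⊛-high k (suc c) f g j =
      trans (+-cong (zeroˡ _) (spread-⊛-high k c f g j)) (+-identityˡ _)

    -- Extracting a residue class is linear over series in q^(k+1). After its constant term
    -- `dilate k f` has k zeros, so for r ≤ k the first coefficient sees `f 0` alone; skipping these
    -- zeros leads to the same claim for the tail of `f`.
    section-dilate-⊛ : ∀ k {r} f g → r ≤ k → section k r (dilate k f ⊛ g) ≋ f ⊛ section k r g
    section-dilate-⊛ k {zero}  f g r≤k .coeff zero = refl
    section-dilate-⊛ k {suc r} f g r<k .coeff zero =
      trans (+-congˡ (spread-⊛-low k k (f ∘ suc) g r<k)) (+-identityʳ _)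
    section-dilate-⊛ k {r}     f g r≤k .coeff (suc n) = +-congˡ (begin
      (spread 0# k k (f ∘ suc) ⊛ g) (k ℕ.+ n ℕ.* suc k ℕ.+ r)
        ≡⟨ ≡.cong (spread 0# k k (f ∘ suc) ⊛ g) (ℕ.+-assoc k (n ℕ.* suc k) r) ⟩
      (spread 0# k k (f ∘ suc) ⊛ g) (k ℕ.+ (n ℕ.* suc k ℕ.+ r))
        ≈⟨ spread-⊛-high k k (f ∘ suc) g _ ⟩
      section k r (dilate k (f ∘ suc) ⊛ g) n
        ≈⟨ section-dilate-⊛ k (f ∘ suc) g r≤k .coeff n ⟩
      ((f ∘ suc) ⊛ section k r g) n ∎)

  -- The offset q^c is passed to `g`, where it only changes the residue class. So one factor can be
  -- split by residues while the other stays whole.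
  section-spread-⊛ : ∀ k {r} c f g → r ≤ k →
                     section k r (spread 0# k c f ⊛ g) ≋ f ⊛ section k r (delay 0# c g)
  section-spread-⊛ k {r} c f g r≤k = S.trans
    (coeffs λ n → spread-⊛ k c f g .coeff (n ℕ.* suc k ℕ.+ r))
    (section-dilate-⊛ k f (delay 0# c g) r≤k)

  -- The substitution q ↦ -q. One sign per step follows the head-tail recursion of `_⊛_`, which
  -- makes multiplicativity an induction.
  alternate : Series → Series
  alternate f zero    = f 0
  alternate f (suc n) = - alternate (f ∘ suc) n

  alternate-cong : ∀ {f g} → f ≋ g → alternate f ≋ alternate g
  alternate-cong f≋g .coeff n = go n f≋g
    where
    go : ∀ n {f g} → f ≋ g → alternate f n ≈ alternate g n
    go zero    f≋g = f≋g .coeff 0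
    go (suc n) f≋g = -‿cong (go n (coeffs (f≋g .coeff ∘ suc)))

  private opaque
    unfolding _⊕_

    alternate-linear : ∀ a f g n →
      alternate (λ i → a * f i + g i) n ≈ a * alternate f n + alternate g n
    alternate-linear a f g zero    = refl
    alternate-linear a f g (suc n) = begin
      - alternate (λ i → a * f (suc i) + g (suc i)) n
        ≈⟨ -‿cong (alternate-linear a (f ∘ suc) (g ∘ suc) n) ⟩
      - (a * alternate (f ∘ suc) n + alternate (g ∘ suc) n)
        ≈⟨ ⁻¹-∙-comm _ _ ⟨
      - (a * alternate (f ∘ suc) n) + - alternate (g ∘ suc) n
        ≈⟨ +-congʳ (-‿distribʳ-* _ _) ⟩
      a * (- alternate (f ∘ suc) n) + - alternate (g ∘ suc) n ∎

    alternate-⊛-coeff : ∀ f g n → alternate (f ⊛ g) n ≈ (alternate f ⊛ alternate g) n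
    alternate-⊛-coeff f g zero    = refl
    alternate-⊛-coeff f g (suc n) = begin
      - alternate (λ i → f 0 * g (suc i) + ((f ∘ suc) ⊛ g) i) n
        ≈⟨ -‿cong (alternate-linear (f 0) (g ∘ suc) ((f ∘ suc) ⊛ g) n) ⟩
      - (f 0 * alternate (g ∘ suc) n + alternate ((f ∘ suc) ⊛ g) n)
        ≈⟨ ⁻¹-∙-comm _ _ ⟨
      - (f 0 * alternate (g ∘ suc) n) + - alternate ((f ∘ suc) ⊛ g) n
        ≈⟨ +-cong (-‿distribʳ-* _ _) (-‿cong (alternate-⊛-coeff (f ∘ suc) g n)) ⟩
      f 0 * (- alternate (g ∘ suc) n) + (⊖ (alternate (f ∘ suc) ⊛ alternate g)) n
        ≈⟨ +-congˡ (Sᵖ.-‿distribˡ-* (alternate (f ∘ suc)) (alternate g) .coeff n) ⟩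
      f 0 * (- alternate (g ∘ suc) n) + ((⊖ alternate (f ∘ suc)) ⊛ alternate g) n ∎

  alternate-⊛ : ∀ f g → alternate (f ⊛ g) ≋ alternate f ⊛ alternate g
  alternate-⊛ f g = coeffs (alternate-⊛-coeff f g)

  alternate-⊕ : ∀ f g → alternate (f ⊕ g) ≋ alternate f ⊕ alternate g
  alternate-⊕ f g = coeffs λ n → trans (go f g n) (sym (⊕-coeff _ _ n))
    where
    go : ∀ f g n → alternate (f ⊕ g) n ≈ alternate f n + alternate g n
    go f g zero    = ⊕-coeff f g 0
    go f g (suc n) = begin
      - alternate ((f ⊕ g) ∘ suc) n
        ≈⟨ -‿cong (alternate-cong (coeffs λ i → trans (⊕-coeff f g (suc i)) (sym (⊕-coeff _ _ i))) .coeff n) ⟩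
      - alternate ((f ∘ suc) ⊕ (g ∘ suc)) n
        ≈⟨ -‿cong (go (f ∘ suc) (g ∘ suc) n) ⟩
      - (alternate (f ∘ suc) n + alternate (g ∘ suc) n)
        ≈⟨ ⁻¹-∙-comm _ _ ⟨
      - alternate (f ∘ suc) n + - alternate (g ∘ suc) n ∎

  alternate-const : ∀ a → alternate (const a) ≋ const a
  alternate-const a .coeff zero    = refl
  alternate-const a .coeff (suc n) = trans (-‿cong (zeros n)) -0#≈0#
    where
    zeros : ∀ n → alternate (λ _ → 0#) n ≈ 0#
    zeros zero    = refl
    zeros (suc n) = trans (-‿cong (zeros n)) -0#≈0#

  section-cong : ∀ k r {f g} → f ≋ g → section k r f ≋ section k r g
  section-cong k r f≋g .coeff n = f≋g .coeff (n ℕ.* suc k ℕ.+ r)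

  section-⊕ : ∀ k r f g → section k r (f ⊕ g) ≋ section k r f ⊕ section k r g
  section-⊕ k r f g .coeff n = trans (⊕-coeff f g (n ℕ.* suc k ℕ.+ r)) (sym (⊕-coeff _ _ n))

  section-delay : ∀ k c r f → section k (c ℕ.+ r) (delay 0# c f) ≋ section k r f
  section-delay k c r f .coeff n = reflexive (≡.trans
    (≡.cong (delay 0# c f) (≡.trans (≡.sym (ℕ.+-assoc (n ℕ.* suc k) c r))
      (≡.trans (≡.cong (ℕ._+ r) (ℕ.+-comm (n ℕ.* suc k) c)) (ℕ.+-assoc c (n ℕ.* suc k) r))))
    (delay-high 0# c f _))

  -- When the shift by c carries class r′ past the end of a block of length k + 1, it arrives at
  -- class r of the next block; the block gained is the factor q in `↑`.
  section-delay-wrap : ∀ k c {r r′} f → r < c → c ℕ.+ r′ ≡ suc k ℕ.+ r →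
                       section k r (delay 0# c f) ≋ ↑ (section k r′ f)
  section-delay-wrap k c {r} {r′} f r<c eq .coeff zero    = reflexive (delay-low 0# c f r<c)
  section-delay-wrap k c {r} {r′} f r<c eq .coeff (suc n) =
    reflexive (≡.trans (≡.cong (delay 0# c f) index) (delay-high 0# c f _))
    where
    index : suc n ℕ.* suc k ℕ.+ r ≡ c ℕ.+ (n ℕ.* suc k ℕ.+ r′)
    index = ≡.trans (≡.cong (ℕ._+ r) (ℕ.+-comm (suc k) (n ℕ.* suc k))) (≡.trans (ℕ.+-assoc (n ℕ.* suc k) (suc k) r)
      (≡.trans (≡.cong (n ℕ.* suc k ℕ.+_) (≡.sym eq)) (≡.trans (≡.sym (ℕ.+-assoc (n ℕ.* suc k) c r′))
      (≡.trans (≡.cong (ℕ._+ r′) (ℕ.+-comm (n ℕ.* suc k) c)) (ℕ.+-assoc c (n ℕ.* suc k) r′)))))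

open import Data.Nat using (_+_; _*_; _%_)
open ≡ using (refl; sym; trans; cong; cong₂; subst; module ≡-Reasoning)

-- Counting overpartitions

-- Counting by bijection becomes counting by equality of sets: apply an injective map to one
-- duplicate-free enumeration and compare members.
unique-length : ∀ {a} {A : Set a} {xs ys : List A} → Unique xs → Unique ys →
                (∀ {x} → x ∈ xs → x ∈ ys) → (∀ {x} → x ∈ ys → x ∈ xs) → length xs ≡ length ys
unique-length u v ⊆ ⊇ = ↭-length (∼bag⇒↭ (unique∧set⇒bag u v (mk⇔ ⊆ ⊇)))

module _ {a} {A : Set a} where

  ∈-delay⁺ : ∀ c (F : ℕ → List A) m {x} → x ∈ F m → x ∈ delay [] c F (c + m)
  ∈-delay⁺ zero    F m x∈ = x∈
  ∈-delay⁺ (suc c) F m x∈ = ∈-delay⁺ c F m x∈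

  ∈-delay⁻ : ∀ c (F : ℕ → List A) n {x} → x ∈ delay [] c F n → ∃ λ m → n ≡ c + m × x ∈ F m
  ∈-delay⁻ zero    F n       x∈ = n , refl , x∈
  ∈-delay⁻ (suc c) F (suc n) x∈ with ∈-delay⁻ c F n x∈
  ... | m , refl , x∈F = m , refl , x∈F

  delay-unique : ∀ c (F : ℕ → List A) → (∀ n → Unique (F n)) → ∀ n → Unique (delay [] c F n)
  delay-unique zero    F u n       = u n
  delay-unique (suc c) F u zero    = []
  delay-unique (suc c) F u (suc n) = delay-unique c F u n

Head : Pred Part 0ℓ → Pred (List Part) 0ℓ
Head Q []      = ⊤
Head Q (p ∷ _) = Q p

head? : ∀ {Q : Pred Part 0ℓ} → Decidable Q → Decidable (Head Q)
head? Q? []      = yes tt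
head? Q? (p ∷ _) = Q? p

-- The overline of the part k preceding a tail puts no condition on that tail.
After : ℕ → Pred (List Part) 0ℓ
After k = Head ((k , false) ⊵_)

AtMost : ℕ → Pred (List Part) 0ℓ
AtMost k = Head (λ p → size p ≤ k)

after : ℕ → ℕ → List (List Part)
after k n = filter (head? ((k , false) ⊵?_)) (overpartitions n)

atMost : ℕ → ℕ → List (List Part)
atMost k n = filter (head? (λ p → size p ≤? k)) (overpartitions n)

module _ {Q : Pred (List Part) 0ℓ} (Q? : Decidable Q) {n : ℕ} where

  ∈-enum⁺ : ∀ {ps} → IsOverpartition n ps → Q ps → ps ∈ filter Q? (overpartitions n)
  ∈-enum⁺ {ps} isO q = ∈-filter⁺ Q? (Equivalence.from (∈-overpartitions n ps) isO) q

  ∈-enum⁻ : ∀ {ps} → ps ∈ filter Q? (overpartitions n) → IsOverpartition n ps × Q ps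
  ∈-enum⁻ {ps} ps∈ with ∈-filter⁻ Q? {xs = overpartitions n} ps∈
  ... | ps∈′ , q = Equivalence.to (∈-overpartitions n ps) ps∈′ , q

cons-overpartition : ∀ {k o m ps} → IsOverpartition m ps → After (suc k) ps →
                     IsOverpartition (suc k + m) ((suc k , o) ∷ ps)
cons-overpartition {ps = []}    (pos , _    , refl) _   = s≤s z≤n ∷ pos , [-]          , refl
cons-overpartition {ps = _ ∷ _} (pos , link , refl) rel = s≤s z≤n ∷ pos , rel ∷ link , refl

uncons-overpartition : ∀ {k o n ps} → IsOverpartition n ((suc k , o) ∷ ps) →
                       ∃ λ m → n ≡ suc k + m × IsOverpartition m ps × After (suc k) ps
uncons-overpartition (_ ∷ pos , [-]        , refl) = _ , refl , (pos , []   , refl) , tt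
uncons-overpartition (_ ∷ pos , rel ∷ link , refl) = _ , refl , (pos , link , refl) , rel

startingWith : Part → ℕ → List (List Part)
startingWith p n = map (p ∷_) (delay [] (size p) (after (size p)) n)

∈-startingWith⁺ : ∀ {k o n ps} → IsOverpartition n ((suc k , o) ∷ ps) →
                  (suc k , o) ∷ ps ∈ startingWith (suc k , o) n
∈-startingWith⁺ {k} isO with uncons-overpartition isO
... | m , refl , isO′ , rel =
  ∈-map⁺ _ (∈-delay⁺ (suc k) (after (suc k)) m (∈-enum⁺ (head? ((suc k , false) ⊵?_)) isO′ rel))

∈-startingWith⁻ : ∀ {k o n ps} → ps ∈ startingWith (suc k , o) n →
                  IsOverpartition n ps × ∃ λ qs → ps ≡ (suc k , o) ∷ qs
∈-startingWith⁻ {k} {o} {n} ps∈ with ∈-map⁻ ((suc k , o) ∷_) ps∈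
... | qs , qs∈ , refl with ∈-delay⁻ (suc k) (after (suc k)) n qs∈
... | m , refl , qs∈′ with ∈-enum⁻ (head? ((suc k , false) ⊵?_)) {m} qs∈′
... | isO , rel = cons-overpartition isO rel , qs , refl

startingWith-unique : ∀ p n → Unique (startingWith p n)
startingWith-unique p n = map⁺ ∷-injectiveʳ
  (delay-unique (size p) (after (size p)) (λ m → filter⁺ (head? _) (overpartitions-unique m)) n)

atMost-unique : ∀ k n → Unique (atMost k n)
atMost-unique k n = filter⁺ (head? _) (overpartitions-unique n)

after-unique : ∀ k n → Unique (after k n)
after-unique k n = filter⁺ (head? _) (overpartitions-unique n)

atMost-disjoint : ∀ {k o n ps} → ps ∈ atMost k n → ¬ ps ∈ startingWith (suc k , o) n
atMost-disjoint {k} {o} {n} ps∈ ps∈′ with ∈-startingWith⁻ {k} {o} {n} ps∈′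
... | _ , _ , refl = ℕ.<-irrefl refl (proj₂ (∈-enum⁻ (head? (λ p → size p ≤? k)) {n} ps∈))

length-startingWith : ∀ p n → length (startingWith p n) ≡ delay 0 (size p) (length ∘ after (size p)) n
length-startingWith p n = trans (length-map (p ∷_) (delay [] (size p) (after (size p)) n)) (delay-map length [] (size p) (after (size p)) n)

-- A tail admissible after a part k + 1 either has all parts at most k or starts with another k + 1,
-- which is not a first occurrence and so cannot be overlined. Hence the tails have generating
-- function Pₖ / (1 - q^(k+1)), expressed without division.
length-after : ∀ k n → length (after (suc k) n) ≡
               length (atMost k n) + delay 0 (suc k) (length ∘ after (suc k)) n
length-after k n = begin
  length (after (suc k) n)
    ≡⟨ unique-length (after-unique (suc k) n)
         (++⁺ (atMost-unique k n) (startingWith-unique _ n)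
              λ (ps∈ , ps∈′) → atMost-disjoint {k} {false} {n} ps∈ ps∈′)
         split join ⟩
  length (atMost k n ++ startingWith (suc k , false) n)
    ≡⟨ length-++ (atMost k n) ⟩
  length (atMost k n) + length (startingWith (suc k , false) n)
    ≡⟨ cong (λ i → length (atMost k n) + i) (length-startingWith (suc k , false) n) ⟩
  length (atMost k n) + delay 0 (suc k) (length ∘ after (suc k)) n ∎
  where
  open ≡-Reasoning

  after? = head? ((suc k , false) ⊵?_)
  atMost? = head? (λ p → size p ≤? k)

  split : ∀ {ps} → ps ∈ after (suc k) n → ps ∈ atMost k n ++ startingWith (suc k , false) n
  split {ps} ps∈ with ∈-enum⁻ after? {n} ps∈
  split {[]} ps∈ | isO , _ = ∈-++⁺ˡ (∈-enum⁺ atMost? isO tt)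
  split {(j , o) ∷ ps} ps∈ | isO , j≤ , first with ℕ.m≤n⇒m<n∨m≡n j≤
  ... | inj₁ (s≤s j≤k) = ∈-++⁺ˡ (∈-enum⁺ atMost? isO j≤k)
  split {(_ , false) ∷ ps} ps∈ | isO , j≤ , first | inj₂ refl =
    ∈-++⁺ʳ (atMost k n) (∈-startingWith⁺ isO)
  split {(_ , true) ∷ ps}  ps∈ | isO , j≤ , first | inj₂ refl = ⊥-elim (first refl refl)

  join : ∀ {ps} → ps ∈ atMost k n ++ startingWith (suc k , false) n → ps ∈ after (suc k) n
  join {ps} ps∈ with ∈-++⁻ (atMost k n) ps∈
  join {ps} _ | inj₂ ps∈ with ∈-startingWith⁻ {k} {false} {n} ps∈
  ... | isO , _ , refl = ∈-enum⁺ after? isO (ℕ.≤-refl , λ ())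
  join {ps} _ | inj₁ ps∈ with ∈-enum⁻ atMost? {n} ps∈
  join {[]} _ | inj₁ ps∈ | isO , _ = ∈-enum⁺ after? isO tt
  join {p ∷ ps} _ | inj₁ ps∈ | isO , p≤k =
    ∈-enum⁺ after? isO (ℕ.m≤n⇒m≤1+n p≤k , λ _ eq → ℕ.<-irrefl (sym eq) (s≤s p≤k))

-- If k + 1 occurs, its first occurrence comes at the head and may be overlined or not. The two
-- choices give the 2 in Pₖ₊₁ = Pₖ (1 + q^(k+1)) / (1 - q^(k+1)) = Pₖ + 2 q^(k+1) Pₖ / (1 -
-- q^(k+1)).
length-atMost : ∀ k n → length (atMost (suc k) n) ≡ length (atMost k n) +
  (delay 0 (suc k) (length ∘ after (suc k)) n + delay 0 (suc k) (length ∘ after (suc k)) n)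
length-atMost k n = begin
  length (atMost (suc k) n)
    ≡⟨ unique-length (atMost-unique (suc k) n)
         (++⁺ (atMost-unique k n) (++⁺ (startingWith-unique _ n) (startingWith-unique _ n) flags) disjoint)
         split join ⟩
  length (atMost k n ++ largest)
    ≡⟨ length-++ (atMost k n) ⟩
  length (atMost k n) + length largest
    ≡⟨ cong (λ i → length (atMost k n) + i) (length-++ (startingWith (suc k , false) n)) ⟩
  length (atMost k n) + (length (startingWith (suc k , false) n) + length (startingWith (suc k , true) n))
    ≡⟨ cong (λ i → length (atMost k n) + i)
         (cong₂ _+_ (length-startingWith (suc k , false) n) (length-startingWith (suc k , true) n)) ⟩
  length (atMost k n) +
    (delay 0 (suc k) (length ∘ after (suc k)) n + delay 0 (suc k) (length ∘ after (suc k)) n) ∎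
  where
  open ≡-Reasoning

  largest = startingWith (suc k , false) n ++ startingWith (suc k , true) n
  atMost? = λ j → head? (λ p → size p ≤? j)

  flags : ∀ {ps} → ¬ (ps ∈ startingWith (suc k , false) n × ps ∈ startingWith (suc k , true) n)
  flags (ps∈ , ps∈′) with ∈-startingWith⁻ {k} {false} {n} ps∈ | ∈-startingWith⁻ {k} {true} {n} ps∈′
  ... | _ , _ , refl | _ , _ , ()

  disjoint : ∀ {ps} → ¬ (ps ∈ atMost k n × ps ∈ largest)
  disjoint (ps∈ , ps∈′) with ∈-++⁻ (startingWith (suc k , false) n) ps∈′
  ... | inj₁ ps∈″ = atMost-disjoint {k} {false} {n} ps∈ ps∈″
  ... | inj₂ ps∈″ = atMost-disjoint {k} {true} {n} ps∈ ps∈″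

  split : ∀ {ps} → ps ∈ atMost (suc k) n → ps ∈ atMost k n ++ largest
  split {ps} ps∈ with ∈-enum⁻ (atMost? (suc k)) {n} ps∈
  split {[]} ps∈ | isO , _ = ∈-++⁺ˡ (∈-enum⁺ (atMost? k) isO tt)
  split {(j , o) ∷ ps} ps∈ | isO , j≤ with ℕ.m≤n⇒m<n∨m≡n j≤
  ... | inj₁ (s≤s j≤k) = ∈-++⁺ˡ (∈-enum⁺ (atMost? k) isO j≤k)
  split {(_ , false) ∷ ps} ps∈ | isO , j≤ | inj₂ refl =
    ∈-++⁺ʳ (atMost k n) (∈-++⁺ˡ (∈-startingWith⁺ isO))
  split {(_ , true) ∷ ps}  ps∈ | isO , j≤ | inj₂ refl =
    ∈-++⁺ʳ (atMost k n) (∈-++⁺ʳ (startingWith (suc k , false) n) (∈-startingWith⁺ isO))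

  starting⊆ : ∀ {o ps} → ps ∈ startingWith (suc k , o) n → ps ∈ atMost (suc k) n
  starting⊆ {o} ps∈ with ∈-startingWith⁻ {k} {o} {n} ps∈
  ... | isO , _ , refl = ∈-enum⁺ (atMost? (suc k)) isO ℕ.≤-refl

  join : ∀ {ps} → ps ∈ atMost k n ++ largest → ps ∈ atMost (suc k) n
  join {ps} ps∈ with ∈-++⁻ (atMost k n) ps∈
  join {ps} _ | inj₂ ps∈ with ∈-++⁻ (startingWith (suc k , false) n) ps∈
  ... | inj₁ ps∈′ = starting⊆ ps∈′
  ... | inj₂ ps∈′ = starting⊆ ps∈′
  join {ps} _ | inj₁ ps∈ with ∈-enum⁻ (atMost? k) {n} ps∈
  join {[]} _ | inj₁ ps∈ | isO , _ = ∈-enum⁺ (atMost? (suc k)) isO tt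
  join {p ∷ ps} _ | inj₁ ps∈ | isO , p≤k = ∈-enum⁺ (atMost? (suc k)) isO (ℕ.m≤n⇒m≤1+n p≤k)

length-atMost-zero : ∀ n → length (atMost 0 (suc n)) ≡ 0
length-atMost-zero n = unique-length (atMost-unique 0 (suc n)) [] none λ ()
  where
  none : ∀ {ps} → ps ∈ atMost 0 (suc n) → ps ∈ []
  none {ps} ps∈ with ∈-enum⁻ (head? (λ p → size p ≤? 0)) {suc n} ps∈
  none {[]}         _ | (_ , _ , ()) , _
  none {(_ , _) ∷ _} _ | (() ∷ _ , _) , z≤n

-- Stabilisation: the bound k on the parts leaves the coefficients up to q^k unchanged.
p̅-atMost : ∀ {n k} → n ≤ k → p̅ n ≡ length (atMost k n)
p̅-atMost {n} {k} n≤k = cong length (sym (filter-all (head? (λ p → size p ≤? k)) (All.tabulate bounded)))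
  where
  bounded : ∀ {ps} → ps ∈ overpartitions n → AtMost k ps
  bounded {[]}     _   = tt
  bounded {p ∷ ps} ps∈ with Equivalence.to (∈-overpartitions n (p ∷ ps)) ps∈
  ... | _ , _ , refl = ℕ.≤-trans (ℕ.m≤m+n (size p) _) n≤k

-- Representations as sums of squares

module _ {a} {A : Set a} where

  length-empty : ∀ {xs : List A} → (∀ {x} → ¬ x ∈ xs) → length xs ≡ 0
  length-empty {[]}    _    = refl
  length-empty {_ ∷ _} none = ⊥-elim (none (here refl))

  ∈-spread⁺ : ∀ k c (F : ℕ → List A) m {x} → x ∈ F m → x ∈ spread [] k c F (c + m * suc k)
  ∈-spread⁺ k zero    F zero    x∈ = x∈
  ∈-spread⁺ k zero    F (suc m) x∈ = ∈-spread⁺ k k (F ∘ suc) m x∈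
  ∈-spread⁺ k (suc c) F m       x∈ = ∈-spread⁺ k c F m x∈

  ∈-spread⁻ : ∀ k c (F : ℕ → List A) n {x} → x ∈ spread [] k c F n →
              ∃ λ m → n ≡ c + m * suc k × x ∈ F m
  ∈-spread⁻ k zero    F zero    x∈ = 0 , refl , x∈
  ∈-spread⁻ k zero    F (suc n) x∈ with ∈-spread⁻ k k (F ∘ suc) n x∈
  ... | m , refl , x∈F = suc m , refl , x∈F
  ∈-spread⁻ k (suc c) F (suc n) x∈ with ∈-spread⁻ k c F n x∈
  ... | m , refl , x∈F = m , refl , x∈F

  spread-unique : ∀ k c (F : ℕ → List A) → (∀ n → Unique (F n)) → ∀ n → Unique (spread [] k c F n)
  spread-unique k zero    F u zero    = u 0
  spread-unique k zero    F u (suc n) = spread-unique k k (F ∘ suc) (u ∘ suc) n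
  spread-unique k (suc c) F u zero    = []
  spread-unique k (suc c) F u (suc n) = spread-unique k c F u n

length-cartesianProduct : ∀ {a b} {A : Set a} {B : Set b} (xs : List A) (ys : List B) →
                          length (cartesianProduct xs ys) ≡ length xs * length ys
length-cartesianProduct []       ys = refl
length-cartesianProduct (x ∷ xs) ys = trans (length-++ (map (x ,_) ys))
  (cong₂ _+_ (length-map (x ,_) ys) (length-cartesianProduct xs ys))

Disjoint-family : ∀ {a} {A : Set a} → (ℕ → List A) → Set a
Disjoint-family F = ∀ {i j x} → x ∈ F i → x ∈ F j → i ≡ j

module _ {a b} {A : Set a} {B : Set b} where

  -- The Cauchy product of enumerations. It repeats the recursion of `_⊛_`, so that `card-pairs` is
  -- a direct induction.
  pairs : (ℕ → List A) → (ℕ → List B) → ℕ → List (A × B)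
  pairs F G zero    = cartesianProduct (F 0) (G 0)
  pairs F G (suc n) = cartesianProduct (F 0) (G (suc n)) ++ pairs (F ∘ suc) G n

  ∈-pairs⁺ : ∀ F G i j {x y} → x ∈ F i → y ∈ G j → (x , y) ∈ pairs F G (i + j)
  ∈-pairs⁺ F G zero    zero    x∈ y∈ = ∈-cartesianProduct⁺ x∈ y∈
  ∈-pairs⁺ F G zero    (suc j) x∈ y∈ = ∈-++⁺ˡ (∈-cartesianProduct⁺ x∈ y∈)
  ∈-pairs⁺ F G (suc i) j       x∈ y∈ =
    ∈-++⁺ʳ (cartesianProduct (F 0) (G (suc i + j))) (∈-pairs⁺ (F ∘ suc) G i j x∈ y∈)

  ∈-pairs⁻ : ∀ F G n {x y} → (x , y) ∈ pairs F G n → ∃₂ λ i j → n ≡ i + j × x ∈ F i × y ∈ G j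
  ∈-pairs⁻ F G zero    xy∈ = 0 , 0 , refl , ∈-cartesianProduct⁻ (F 0) (G 0) xy∈
  ∈-pairs⁻ F G (suc n) xy∈ with ∈-++⁻ (cartesianProduct (F 0) (G (suc n))) xy∈
  ... | inj₁ xy∈₀ = 0 , suc n , refl , ∈-cartesianProduct⁻ (F 0) (G (suc n)) xy∈₀
  ... | inj₂ xy∈′ with ∈-pairs⁻ (F ∘ suc) G n xy∈′
  ... | i , j , refl , x∈ , y∈ = suc i , j , refl , x∈ , y∈

  pairs-unique : ∀ F G → (∀ n → Unique (F n)) → (∀ n → Unique (G n)) → Disjoint-family F →
                 ∀ n → Unique (pairs F G n)
  pairs-unique F G uF uG dF zero    = cartesianProduct⁺ (uF 0) (uG 0)
  pairs-unique F G uF uG dF (suc n) = ++⁺ (cartesianProduct⁺ (uF 0) (uG (suc n)))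
    (pairs-unique (F ∘ suc) G (uF ∘ suc) uG (λ p q → ℕ.suc-injective (dF p q)) n) disjoint
    where
    disjoint : ∀ {xy} → ¬ (xy ∈ cartesianProduct (F 0) (G (suc n)) × xy ∈ pairs (F ∘ suc) G n)
    disjoint (p , q) with ∈-cartesianProduct⁻ (F 0) (G (suc n)) p | ∈-pairs⁻ (F ∘ suc) G n q
    ... | x∈ , _ | _ , _ , _ , x∈′ , _ with () ← dF x∈ x∈′

sq : ℤ → ℕ
sq x = ∣ x ∣ * ∣ x ∣

ints : ℕ → List ℤ
ints zero    = 0ℤ ∷ []
ints (suc n) = + suc n ∷ -[1+ n ] ∷ ints n

∈-ints⁺ : ∀ {n} x → ∣ x ∣ ≤ n → x ∈ ints n
∈-ints⁺ {zero}  (+ zero) z≤n = here refl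
∈-ints⁺ {suc n} x ≤n with ℕ.m≤n⇒m<n∨m≡n ≤n
... | inj₁ (s≤s <n) = there (there (∈-ints⁺ x <n))
∈-ints⁺ {suc n} (+ _)      _ | inj₂ refl = here refl
∈-ints⁺ {suc n} (-[1+ _ ]) _ | inj₂ refl = there (here refl)

∈-ints⁻ : ∀ {n x} → x ∈ ints n → ∣ x ∣ ≤ n
∈-ints⁻ {zero}  (here refl)         = z≤n
∈-ints⁻ {suc n} (here refl)         = ℕ.≤-refl
∈-ints⁻ {suc n} (there (here refl)) = ℕ.≤-refl
∈-ints⁻ {suc n} (there (there x∈))  = ℕ.m≤n⇒m≤1+n (∈-ints⁻ x∈)

ints-unique : ∀ n → Unique (ints n)
ints-unique zero    = [] ∷ []
ints-unique (suc n) =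
  ((λ ()) ∷ All.tabulate (λ x∈ → λ { refl → ℕ.<-irrefl refl (∈-ints⁻ x∈) })) ∷
  All.tabulate (λ x∈ → λ { refl → ℕ.<-irrefl refl (∈-ints⁻ x∈) }) ∷ ints-unique n

-- For fixed `N` the lengths are the coefficients of Σ q^(j²) over |j| ≤ N, the truncated theta
-- series. Since |x| ≤ x², the bound m suffices to find all square roots of m, as in `roots`.
rootsUpTo : ℕ → ℕ → List ℤ
rootsUpTo N m = filter (λ x → sq x ℕ.≟ m) (ints N)

roots : ℕ → List ℤ
roots m = rootsUpTo m m

rootsUpTo-unique : ∀ N m → Unique (rootsUpTo N m)
rootsUpTo-unique N m = filter⁺ (λ x → sq x ℕ.≟ m) (ints-unique N)

roots-unique : ∀ m → Unique (roots m)
roots-unique m = rootsUpTo-unique m m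

n≤n*n : ∀ n → n ≤ n * n
n≤n*n zero    = z≤n
n≤n*n (suc n) = ℕ.m≤m*n (suc n) (suc n)

∈-rootsUpTo⁺ : ∀ {N} x → sq x ≤ N → x ∈ rootsUpTo N (sq x)
∈-rootsUpTo⁺ x ≤N = ∈-filter⁺ _ (∈-ints⁺ x (ℕ.≤-trans (n≤n*n ∣ x ∣) ≤N)) refl

∈-rootsUpTo⁻ : ∀ N {m x} → x ∈ rootsUpTo N m → sq x ≡ m
∈-rootsUpTo⁻ N {m} x∈ = proj₂ (∈-filter⁻ (λ x → sq x ℕ.≟ m) {xs = ints N} x∈)

∈-roots⁺ : ∀ {m} x → sq x ≡ m → x ∈ roots m
∈-roots⁺ x refl = ∈-rootsUpTo⁺ x ℕ.≤-refl

∈-roots⁻ : ∀ {m x} → x ∈ roots m → sq x ≡ m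
∈-roots⁻ {m} = ∈-rootsUpTo⁻ m

length-roots : ∀ {m N} → m ≤ N → length (roots m) ≡ length (rootsUpTo N m)
length-roots {m} {N} m≤N = unique-length (roots-unique m) (rootsUpTo-unique N m)
  (λ {x} x∈ → grow x (∈-roots⁻ x∈)) (λ {x} x∈ → ∈-roots⁺ x (∈-rootsUpTo⁻ N x∈))
  where
  grow : ∀ x → sq x ≡ m → x ∈ rootsUpTo N m
  grow x refl = ∈-rootsUpTo⁺ x m≤N

unit : ℕ → ℕ
unit zero    = 1
unit (suc _) = 0

indicator : ℕ → ℕ → ℕ
indicator c = delay 0 c unit

indicator-refl : ∀ c → indicator c c ≡ 1
indicator-refl zero    = refl
indicator-refl (suc c) = indicator-refl c

indicator-≢ : ∀ c n → c ≢ n → indicator c n ≡ 0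
indicator-≢ zero    zero    c≢n = ⊥-elim (c≢n refl)
indicator-≢ zero    (suc n) _   = refl
indicator-≢ (suc c) zero    _   = refl
indicator-≢ (suc c) (suc n) c≢n = indicator-≢ c n (c≢n ∘ cong suc)

length-rootsUpTo-zero : ∀ m → length (rootsUpTo 0 m) ≡ indicator 0 m
length-rootsUpTo-zero zero    = refl
length-rootsUpTo-zero (suc m) = refl

length-rootsUpTo-suc : ∀ N m → length (rootsUpTo (suc N) m) ≡
  length (rootsUpTo N m) + (indicator (suc N * suc N) m + indicator (suc N * suc N) m)
length-rootsUpTo-suc N m with suc N * suc N ℕ.≟ m
... | yes refl = begin
  length (rootsUpTo (suc N) m)
    ≡⟨ cong length (trans (filter-accept P? { + suc N} { -[1+ N ] ∷ ints N} refl)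
                          (cong (+ suc N ∷_) (filter-accept P? { -[1+ N ]} {ints N} refl))) ⟩
  2 + length (rootsUpTo N m)
    ≡⟨ ℕ.+-comm 2 _ ⟩
  length (rootsUpTo N m) + 2
    ≡⟨ cong (λ i → length (rootsUpTo N m) + (i + i)) (indicator-refl (suc N * suc N)) ⟨
  length (rootsUpTo N m) + (indicator (suc N * suc N) m + indicator (suc N * suc N) m) ∎
  where
  open ≡-Reasoning
  P? = λ x → sq x ℕ.≟ m
... | no ≢m = begin
  length (rootsUpTo (suc N) m)
    ≡⟨ cong length (trans (filter-reject P? { + suc N} { -[1+ N ] ∷ ints N} ≢m)
                          (filter-reject P? { -[1+ N ]} {ints N} ≢m)) ⟩
  length (rootsUpTo N m)
    ≡⟨ ℕ.+-identityʳ _ ⟨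
  length (rootsUpTo N m) + 0
    ≡⟨ cong (λ i → length (rootsUpTo N m) + (i + i)) (indicator-≢ (suc N * suc N) m ≢m) ⟨
  length (rootsUpTo N m) + (indicator (suc N * suc N) m + indicator (suc N * suc N) m) ∎
  where
  open ≡-Reasoning
  P? = λ x → sq x ℕ.≟ m

module _ where
  open ℕS.+-*-Solver

  square-mod-4 : ∀ k → (∃ λ i → k ≡ i * 2) ⊎ (∃ λ j → k * k ≡ j * 4 + 1)
  square-mod-4 0 = inj₁ (0 , refl)
  square-mod-4 1 = inj₂ (0 , refl)
  square-mod-4 (suc (suc k)) with square-mod-4 k
  ... | inj₁ (i , refl) = inj₁ (suc i , refl)
  ... | inj₂ (j , eq) = inj₂ (j + k + 1 , trans
    (solve 1 (λ k → (con 2 :+ k) :* (con 2 :+ k) := k :* k :+ (con 4 :* k :+ con 4)) refl k)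
    (trans (cong (_+ (4 * k + 4)) eq)
      (solve 2 (λ j k → j :* con 4 :+ con 1 :+ (con 4 :* k :+ con 4) := (j :+ k :+ con 1) :* con 4 :+ con 1) refl j k)))

  shift-5 : ∀ k j r → k * k ≡ j * 5 + r → (5 + k) * (5 + k) ≡ (j + 2 * k + 5) * 5 + r
  shift-5 k j r eq = trans
    (solve 1 (λ k → (con 5 :+ k) :* (con 5 :+ k) := k :* k :+ (con 10 :* k :+ con 25)) refl k)
    (trans (cong (_+ (10 * k + 25)) eq)
      (solve 3 (λ j k r → j :* con 5 :+ r :+ (con 10 :* k :+ con 25) := (j :+ con 2 :* k :+ con 5) :* con 5 :+ r) refl j k r))

  square-mod-5 : ∀ k → (∃ λ i → k ≡ i * 5) ⊎ (∃ λ j → k * k ≡ j * 5 + 1) ⊎ (∃ λ j → k * k ≡ j * 5 + 4)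
  square-mod-5 0 = inj₁ (0 , refl)
  square-mod-5 1 = inj₂ (inj₁ (0 , refl))
  square-mod-5 2 = inj₂ (inj₂ (0 , refl))
  square-mod-5 3 = inj₂ (inj₂ (1 , refl))
  square-mod-5 4 = inj₂ (inj₁ (3 , refl))
  square-mod-5 (suc (suc (suc (suc (suc k))))) with square-mod-5 k
  ... | inj₁ (i , refl)      = inj₁ (suc i , refl)
  ... | inj₂ (inj₁ (j , eq)) = inj₂ (inj₁ (j + 2 * k + 5 , shift-5 k j 1 eq))
  ... | inj₂ (inj₂ (j , eq)) = inj₂ (inj₂ (j + 2 * k + 5 , shift-5 k j 4 eq))

residue : ∀ m q r → r < suc m → (q * suc m + r) % suc m ≡ r
residue m q r r< = begin
  (q * suc m + r) % suc m ≡⟨ cong (_% suc m) (ℕ.+-comm (q * suc m) r) ⟩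
  (r + q * suc m) % suc m ≡⟨ [m+kn]%n≡m%n r q (suc m) ⟩
  r % suc m               ≡⟨ m<n⇒m%n≡m r< ⟩
  r                       ∎
  where open ≡-Reasoning

-- Sums of two squares and the Gaussian integers

module _ where
  open ≡-Reasoning

  +sq : ∀ x → + sq x ≡ x ℤ.* x
  +sq (+ n)      = ℤ.pos-* n n
  +sq (-[1+ n ]) = refl

  sq-* : ∀ x y → sq (x ℤ.* y) ≡ sq x * sq y
  sq-* x y = trans (cong (λ a → a * a) (ℤ.abs-* x y)) (ℕ.[m*n]*[o*p]≡[m*o]*[n*p] (∣ x ∣) (∣ y ∣) (∣ x ∣) (∣ y ∣))

  norm : ℤ × ℤ → ℕ
  norm (x , y) = sq x + sq y

  +norm : ∀ p → + norm p ≡ proj₁ p ℤ.* proj₁ p ℤ.+ proj₂ p ℤ.* proj₂ p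
  +norm (x , y) = trans (ℤ.pos-+ (sq x) (sq y)) (cong₂ ℤ._+_ (+sq x) (+sq y))

  -- Multiplication by 2 + i on the Gaussian integers.
  rotate : ℤ × ℤ → ℤ × ℤ
  rotate (u , v) = + 2 ℤ.* u ℤ.- v , u ℤ.+ + 2 ℤ.* v

  module _ where
    open ℤS.+-*-Solver

    norm-rotate : ∀ p → norm (rotate p) ≡ norm p * 5
    norm-rotate p@(u , v) = ℤ.+-injective (begin
      + norm (rotate p)
        ≡⟨ +norm (rotate p) ⟩
      x ℤ.* x ℤ.+ y ℤ.* y
        ≡⟨ solve 2 (λ u v → (con (+ 2) :* u :- v) :* (con (+ 2) :* u :- v) :+ (u :+ con (+ 2) :* v) :* (u :+ con (+ 2) :* v)
                          := (u :* u :+ v :* v) :* con (+ 5)) refl u v ⟩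
      (u ℤ.* u ℤ.+ v ℤ.* v) ℤ.* + 5
        ≡⟨ cong (ℤ._* + 5) (+norm p) ⟨
      + norm p ℤ.* + 5
        ≡⟨ ℤ.pos-* (norm p) 5 ⟨
      + (norm p * 5) ∎)
      where
      x = + 2 ℤ.* u ℤ.- v
      y = u ℤ.+ + 2 ℤ.* v

    -- Multiplication by the conjugate: (2 - i)(x + iy) = (2x + y) + (2y - x)i, while (2 - i)(2 + i)
    -- = 5. Together with `rotate-snd` this inverts `rotate` up to the factor 5.
    rotate-fst : ∀ p → + 2 ℤ.* proj₁ (rotate p) ℤ.+ proj₂ (rotate p) ≡ + 5 ℤ.* proj₁ p
    rotate-fst (u , v) =
      solve 2 (λ u v → con (+ 2) :* (con (+ 2) :* u :- v) :+ (u :+ con (+ 2) :* v) := con (+ 5) :* u) refl u v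

    rotate-snd : ∀ p → + 2 ℤ.* proj₂ (rotate p) ℤ.- proj₁ (rotate p) ≡ + 5 ℤ.* proj₂ p
    rotate-snd (u , v) =
      solve 2 (λ u v → con (+ 2) :* (u :+ con (+ 2) :* v) :- (con (+ 2) :* u :- v) := con (+ 5) :* v) refl u v

    rotate-injective : ∀ {p q} → rotate p ≡ rotate q → p ≡ q
    rotate-injective {p} {q} eq = cong₂ _,_
      (ℤ.*-cancelˡ-≡ (+ 5) _ _ (trans (sym (rotate-fst p))
        (trans (cong (λ (x , y) → + 2 ℤ.* x ℤ.+ y) eq) (rotate-fst q))))
      (ℤ.*-cancelˡ-≡ (+ 5) _ _ (trans (sym (rotate-snd p))
        (trans (cong (λ (x , y) → + 2 ℤ.* y ℤ.- x) eq) (rotate-snd q))))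

    rotate-divisible : ∀ p {z} → proj₁ (rotate p) ≡ z ℤ.* + 5 → ∃ λ w → proj₂ (rotate p) ≡ w ℤ.* + 5
    -- On the image y = 3x + 5(v - u); the witness comes from x = 5z.
    rotate-divisible (u , v) {z} eq = + 3 ℤ.* z ℤ.- u ℤ.+ v , (begin
      u ℤ.+ + 2 ℤ.* v
        ≡⟨ solve 2 (λ u v → u :+ con (+ 2) :* v := con (+ 3) :* (con (+ 2) :* u :- v) :+ (v :- u) :* con (+ 5)) refl u v ⟩
      + 3 ℤ.* (+ 2 ℤ.* u ℤ.- v) ℤ.+ (v ℤ.- u) ℤ.* + 5
        ≡⟨ cong (λ x → + 3 ℤ.* x ℤ.+ (v ℤ.- u) ℤ.* + 5) eq ⟩
      + 3 ℤ.* (z ℤ.* + 5) ℤ.+ (v ℤ.- u) ℤ.* + 5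
        ≡⟨ solve 3 (λ z u v → con (+ 3) :* (z :* con (+ 5)) :+ (v :- u) :* con (+ 5) := (con (+ 3) :* z :- u :+ v) :* con (+ 5)) refl z u v ⟩
      (+ 3 ℤ.* z ℤ.- u ℤ.+ v) ℤ.* + 5 ∎)

    -- If (x, y) and (y, x) are both multiples of 2 + i, then 2x + y and 2y + x vanish mod 5, and so
    -- does 3x. The witness comes from x = 4(2x + y) - 2(2y + x) - 5x.
    rotate-swap-divisible : ∀ p q → rotate p ≡ swap (rotate q) → ∃ λ z → proj₁ (rotate p) ≡ z ℤ.* + 5
    rotate-swap-divisible p@(u , v) q@(u′ , v′) eq = + 4 ℤ.* u ℤ.- + 2 ℤ.* u′ ℤ.- x , (begin
      x
        ≡⟨ solve 2 (λ x y → x := con (+ 4) :* (con (+ 2) :* x :+ y) :- con (+ 2) :* (con (+ 2) :* y :+ x) :- con (+ 5) :* x) refl x y ⟩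
      + 4 ℤ.* (+ 2 ℤ.* x ℤ.+ y) ℤ.- + 2 ℤ.* (+ 2 ℤ.* y ℤ.+ x) ℤ.- + 5 ℤ.* x
        ≡⟨ cong₂ (λ a b → + 4 ℤ.* a ℤ.- + 2 ℤ.* b ℤ.- + 5 ℤ.* x) (rotate-fst p)
             (trans (cong (λ (a , b) → + 2 ℤ.* b ℤ.+ a) eq) (rotate-fst q)) ⟩
      + 4 ℤ.* (+ 5 ℤ.* u) ℤ.- + 2 ℤ.* (+ 5 ℤ.* u′) ℤ.- + 5 ℤ.* x
        ≡⟨ solve 3 (λ u u′ x → con (+ 4) :* (con (+ 5) :* u) :- con (+ 2) :* (con (+ 5) :* u′) :- con (+ 5) :* x
                            := (con (+ 4) :* u :- con (+ 2) :* u′ :- x) :* con (+ 5)) refl u u′ x ⟩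
      (+ 4 ℤ.* u ℤ.- + 2 ℤ.* u′ ℤ.- x) ℤ.* + 5 ∎)
      where
      x = proj₁ (rotate p)
      y = proj₂ (rotate p)

    -- The preimage is (2 - i)(z + iw), because 5 = (2 + i)(2 - i).
    rotate-hits-multiple : ∀ z w → rotate (+ 2 ℤ.* z ℤ.+ w , + 2 ℤ.* w ℤ.- z) ≡ (z ℤ.* + 5 , w ℤ.* + 5)
    rotate-hits-multiple z w = cong₂ _,_
      (solve 2 (λ z w → con (+ 2) :* (con (+ 2) :* z :+ w) :- (con (+ 2) :* w :- z) := z :* con (+ 5)) refl z w)
      (solve 2 (λ z w → con (+ 2) :* z :+ w :+ con (+ 2) :* (con (+ 2) :* w :- z) := w :* con (+ 5)) refl z w)

    -- Division by 2 + i is (2 - i)(x + iy) / 5. Its real part is (2x + y)/5 = k, and substituting y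
    -- = 5k - 2x in (2y - x)/5 gives 2k - x.
    rotate-hits : ∀ {x y k} → + 2 ℤ.* x ℤ.+ y ≡ k ℤ.* + 5 → rotate (k , + 2 ℤ.* k ℤ.- x) ≡ (x , y)
    rotate-hits {x} {y} {k} eq = cong₂ _,_
      (solve 2 (λ k x → con (+ 2) :* k :- (con (+ 2) :* k :- x) := x) refl k x)
      (begin
        k ℤ.+ + 2 ℤ.* (+ 2 ℤ.* k ℤ.- x)
          ≡⟨ solve 2 (λ k x → k :+ con (+ 2) :* (con (+ 2) :* k :- x) := k :* con (+ 5) :- con (+ 2) :* x) refl k x ⟩
        k ℤ.* + 5 ℤ.- + 2 ℤ.* x
          ≡⟨ cong (ℤ._- + 2 ℤ.* x) eq ⟨
        + 2 ℤ.* x ℤ.+ y ℤ.- + 2 ℤ.* x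
          ≡⟨ solve 2 (λ x y → con (+ 2) :* x :+ y :- con (+ 2) :* x := y) refl x y ⟩
        y ∎)

    -- The same division applied to y + ix: the imaginary part is (2x - y)/5 = k, and y = 2x - 5k
    -- makes the real part (2y + x)/5 equal to x - 2k.
    rotate-hits-swapped : ∀ {x y k} → + 2 ℤ.* x ℤ.- y ≡ k ℤ.* + 5 → rotate (x ℤ.- + 2 ℤ.* k , k) ≡ (y , x)
    rotate-hits-swapped {x} {y} {k} eq = cong₂ _,_
      (begin
        + 2 ℤ.* (x ℤ.- + 2 ℤ.* k) ℤ.- k
          ≡⟨ solve 2 (λ k x → con (+ 2) :* (x :- con (+ 2) :* k) :- k := con (+ 2) :* x :- k :* con (+ 5)) refl k x ⟩
        + 2 ℤ.* x ℤ.- k ℤ.* + 5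
          ≡⟨ cong (λ a → + 2 ℤ.* x ℤ.- a) eq ⟨
        + 2 ℤ.* x ℤ.- (+ 2 ℤ.* x ℤ.- y)
          ≡⟨ solve 2 (λ x y → con (+ 2) :* x :- (con (+ 2) :* x :- y) := y) refl x y ⟩
        y ∎)
      (solve 2 (λ k x → x :- con (+ 2) :* k :+ con (+ 2) :* k := x) refl k x)

    square : ∀ {x j r} → sq x ≡ j * 5 + r → x ℤ.* x ≡ + j ℤ.* + 5 ℤ.+ + r
    square {x} {j} {r} eq = begin
      x ℤ.* x                ≡⟨ +sq x ⟨
      + sq x                 ≡⟨ cong +_ eq ⟩
      + (j * 5 + r)          ≡⟨ ℤ.pos-+ (j * 5) r ⟩
      + (j * 5) ℤ.+ + r      ≡⟨ cong (ℤ._+ + r) (ℤ.pos-* j 5) ⟩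
      + j ℤ.* + 5 ℤ.+ + r    ∎

    square∣ : ∀ {x j r} → sq x ≡ j * 5 + r → + 5 ∣ℤ x ℤ.* x ℤ.- + r
    square∣ {x} {j} {r} eq = ℤ∣.divides (+ j) (trans (cong (ℤ._- + r) (square {x} {j} eq))
      (solve 2 (λ j r → j :* con (+ 5) :+ r :- r := j :* con (+ 5)) refl (+ j) (+ r)))

    -- From x⁵ - x = x (x² - 1)(x² + 1): the residue of x² mod 5 decides which factor is divisible
    -- by 5.
    fermat-5 : ∀ x → + 5 ∣ℤ x ℤ.^ 5 ℤ.- x
    fermat-5 x with square-mod-5 (∣ x ∣)
    ... | inj₁ (i , eq) = subst (+ 5 ∣ℤ_)
      (solve 1 (λ x → (x :* x :* x :* x :- con 1ℤ) :* x := x :* (x :* (x :* (x :* (x :* con 1ℤ)))) :- x) refl x)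
      (ℤ∣.∣n⇒∣m*n (x ℤ.* x ℤ.* x ℤ.* x ℤ.- 1ℤ) (ℤ∣.∣ᵤ⇒∣ (ℕ∣.divides i eq)))
    ... | inj₂ (inj₁ (j , eq)) = subst (+ 5 ∣ℤ_)
      (solve 1 (λ x → x :* (x :* x :+ con 1ℤ) :* (x :* x :- con (+ 1)) :=
                      x :* (x :* (x :* (x :* (x :* con 1ℤ)))) :- x) refl x)
      (ℤ∣.∣n⇒∣m*n (x ℤ.* (x ℤ.* x ℤ.+ 1ℤ)) (square∣ {x} {j} eq))
    -- Here x² = 4 mod 5, and x² + 1 is taken as (x² - 4) + 5.
    ... | inj₂ (inj₂ (j , eq)) = subst (+ 5 ∣ℤ_)
      (solve 1 (λ x → x :* (x :* x :- con 1ℤ) :* ((x :* x :- con (+ 4)) :+ con (+ 5)) :=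
                      x :* (x :* (x :* (x :* (x :* con 1ℤ)))) :- x) refl x)
      (ℤ∣.∣n⇒∣m*n (x ℤ.* (x ℤ.* x ℤ.- 1ℤ)) (ℤ∣.∣m∣n⇒∣m+n (square∣ {x} {j} eq) (ℤ∣.divides 1ℤ refl)))

    sign-involutive : ∀ n → -1ℤ ℤ.^ n ℤ.* -1ℤ ℤ.^ n ≡ 1ℤ
    sign-involutive zero    = refl
    sign-involutive (suc n) = trans
      (solve 1 (λ s → (con -1ℤ :* s) :* (con -1ℤ :* s) := s :* s) refl (-1ℤ ℤ.^ n)) (sign-involutive n)

    sign-4n : ∀ n → -1ℤ ℤ.^ (n * 4) ≡ 1ℤ
    sign-4n n = trans (sym (ℤ.^-*-assoc -1ℤ n 4))
      (trans (solve 1 (λ s → s :* (s :* (s :* (s :* con 1ℤ))) := s :* s :* (s :* s)) refl s)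
        (cong₂ ℤ._*_ (sign-involutive n) (sign-involutive n)))
      where
      s = -1ℤ ℤ.^ n

    sign-5n : ∀ n → -1ℤ ℤ.^ (n * 5) ≡ -1ℤ ℤ.^ n
    sign-5n n = trans (cong (-1ℤ ℤ.^_) (ℕ.*-suc n 4)) (trans (ℤ.^-distribˡ-+-* -1ℤ n (n * 4))
      (trans (cong (-1ℤ ℤ.^ n ℤ.*_) (sign-4n n)) (ℤ.*-identityʳ (-1ℤ ℤ.^ n))))

    -- 4x² − y² = (2x + y)(2x − y) is divisible by 5.
    split-mod-5 : ∀ x y {j j′} → sq x ≡ j * 5 + 1 → sq y ≡ j′ * 5 + 4 →
                  (∃ λ k → + 2 ℤ.* x ℤ.+ y ≡ k ℤ.* + 5) ⊎ (∃ λ k → + 2 ℤ.* x ℤ.- y ≡ k ℤ.* + 5)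
    split-mod-5 x y {j} {j′} x≡ y≡ = Sum.map extract extract
      (euclidsLemma (∣ + 2 ℤ.* x ℤ.+ y ∣) (∣ + 2 ℤ.* x ℤ.- y ∣) (from-yes (prime? 5))
        (subst (5 ∣ℕ_) (ℤ.abs-* (+ 2 ℤ.* x ℤ.+ y) (+ 2 ℤ.* x ℤ.- y))
          (ℤ∣.∣⇒∣ᵤ (ℤ∣.divides (+ 4 ℤ.* + j ℤ.- + j′) factored))))
      where
      extract : ∀ {a} → 5 ∣ℕ ∣ a ∣ → ∃ λ k → a ≡ k ℤ.* + 5
      extract {a} 5∣a with ℤ∣.∣ᵤ⇒∣ {+ 5} {a} 5∣a
      ... | ℤ∣.divides k eq = k , eq

      factored : (+ 2 ℤ.* x ℤ.+ y) ℤ.* (+ 2 ℤ.* x ℤ.- y) ≡ (+ 4 ℤ.* + j ℤ.- + j′) ℤ.* + 5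
      factored = begin
        (+ 2 ℤ.* x ℤ.+ y) ℤ.* (+ 2 ℤ.* x ℤ.- y)
          ≡⟨ solve 2 (λ x y → (con (+ 2) :* x :+ y) :* (con (+ 2) :* x :- y) := con (+ 4) :* (x :* x) :- y :* y) refl x y ⟩
        + 4 ℤ.* (x ℤ.* x) ℤ.- y ℤ.* y
          ≡⟨ cong₂ (λ a b → + 4 ℤ.* a ℤ.- b) (square {x} {j} x≡) (square {y} {j′} y≡) ⟩
        + 4 ℤ.* (+ j ℤ.* + 5 ℤ.+ + 1) ℤ.- (+ j′ ℤ.* + 5 ℤ.+ + 4)
          ≡⟨ solve 2 (λ j j′ → con (+ 4) :* (j :* con (+ 5) :+ con (+ 1)) :- (j′ :* con (+ 5) :+ con (+ 4))
                             := (con (+ 4) :* j :- j′) :* con (+ 5)) refl (+ j) (+ j′) ⟩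
        (+ 4 ℤ.* + j ℤ.- + j′) ℤ.* + 5 ∎

  -- Pairs (x, y) with x² = 1 and y² = 4 mod 5 satisfy 2x + y = 0 or 2x − y = 0 mod 5.
  -- The image of rotate consists of the pairs with 2x + y = 0 mod 5; those with
  -- x² = 4 among them are swapped, which gives the solutions of 2x − y = 0 with x² = 1.
  orient : ℤ × ℤ → ℤ × ℤ
  orient (x , y) with sq x % 5 ℕ.≟ 4
  ... | yes _ = y , x
  ... | no  _ = x , y

  orient-swap : ∀ {x y} → sq x % 5 ≡ 4 → orient (x , y) ≡ (y , x)
  orient-swap {x} eq with sq x % 5 ℕ.≟ 4
  ... | yes _ = refl
  ... | no ≢4 = ⊥-elim (≢4 eq)

  orient-keep : ∀ {x y} → sq x % 5 ≢ 4 → orient (x , y) ≡ (x , y)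
  orient-keep {x} ≢4 with sq x % 5 ℕ.≟ 4
  ... | yes eq = ⊥-elim (≢4 eq)
  ... | no _   = refl

  abs-multiple : ∀ {x i} m → ∣ x ∣ ≡ i * m → ∃ λ z → x ≡ z ℤ.* + m
  abs-multiple {x} {i} m eq with ℤ∣.∣ᵤ⇒∣ {+ m} {x} (ℕ∣.divides i eq)
  ... | ℤ∣.divides z x≡ = z , x≡

  divisible⇒sq%5 : ∀ {x z} → x ≡ z ℤ.* + 5 → sq x % 5 ≡ 0
  divisible⇒sq%5 {z = z} refl = begin
    sq (z ℤ.* + 5) % 5       ≡⟨ cong (_% 5) (sq-* z (+ 5)) ⟩
    (sq z * 25) % 5          ≡⟨ cong (_% 5) (trans (sym (ℕ.*-assoc (sq z) 5 5)) (sym (ℕ.+-identityʳ _))) ⟩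
    (sq z * 5 * 5 + 0) % 5   ≡⟨ residue 4 (sq z * 5) 0 (s≤s z≤n) ⟩
    0                        ∎

  multiple-sq%5 : ∀ {x i} → ∣ x ∣ ≡ i * 5 → sq x % 5 ≡ 0
  multiple-sq%5 {x} {i} eq with abs-multiple {x} {i} 5 eq
  ... | z , x≡ = divisible⇒sq%5 {x} {z} x≡

  divisible-orient : ∀ {x y z} → x ≡ z ℤ.* + 5 → orient (x , y) ≡ (x , y)
  divisible-orient {x} {y} {z} eq = orient-keep {x} {y} λ ≡4 → 0≢4 (trans (sym (divisible⇒sq%5 {x} {z} eq)) ≡4)
    where
    0≢4 : 0 ≢ 4
    0≢4 ()

  fold : ℤ × ℤ → ℤ × ℤ
  fold = orient ∘ rotate

  -- Collisions between a swapped and an unswapped image are the only danger. They would put (x, y)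
  -- and (y, x) both in the image of `rotate`, forcing 5 to divide an entry whose square is 4 mod 5.
  fold-injective : ∀ {p q} → fold p ≡ fold q → p ≡ q
  fold-injective {p} {q} eq with sq (proj₁ (rotate p)) % 5 ℕ.≟ 4 | sq (proj₁ (rotate q)) % 5 ℕ.≟ 4
  ... | yes _ | yes _ = rotate-injective {p} {q} (cong swap eq)
  ... | no  _ | no  _ = rotate-injective {p} {q} eq
  ... | yes p4 | no _ with rotate-swap-divisible p q (cong swap eq)
  ...   | z , div with () ← trans (sym (divisible⇒sq%5 {z = z} div)) p4
  fold-injective {p} {q} eq | no _ | yes q4 with rotate-swap-divisible q p (cong swap (sym eq))
  ...   | z , div with () ← trans (sym (divisible⇒sq%5 {z = z} div)) q4

  dilatedRoots : ℕ → List ℤ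
  dilatedRoots = spread [] 4 0 roots

  -- A root of 5j + 1 is filed under j + 1. Paired with a root of 5j′ + 4 filed under j′, it then
  -- sits at (x² + y²)/5 = j + 1 + j′; the shift is the factor q of q θ₁ θ₄.
  roots₁ roots₄ : ℕ → List ℤ
  roots₁ = delay [] 1 (section 4 1 roots)
  roots₄ = section 4 4 roots

  ∈-dilatedRoots⁺ : ∀ z → z ∈ dilatedRoots (sq z * 5)
  ∈-dilatedRoots⁺ z = ∈-spread⁺ 4 0 roots (sq z) (∈-roots⁺ z refl)

  ∈-dilatedRoots⁻ : ∀ {n z} → z ∈ dilatedRoots n → n ≡ sq z * 5
  ∈-dilatedRoots⁻ {n} {z} z∈ with ∈-spread⁻ 4 0 roots n z∈
  ... | m , refl , z∈m = cong (_* 5) (sym (∈-roots⁻ {m} {z} z∈m))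

  ∈-roots₁⁺ : ∀ {j} x → sq x ≡ j * 5 + 1 → x ∈ roots₁ (suc j)
  ∈-roots₁⁺ x eq = ∈-roots⁺ x eq

  ∈-roots₁⁻ : ∀ {n x} → x ∈ roots₁ n → ∃ λ j → n ≡ suc j × sq x ≡ j * 5 + 1
  ∈-roots₁⁻ {suc j} x∈ = j , refl , ∈-roots⁻ x∈

  ∈-multiples⁻ : ∀ {n xy} → xy ∈ map (λ (z , w) → z ℤ.* + 5 , w ℤ.* + 5) (pairs dilatedRoots dilatedRoots n) →
                 ∃₂ λ z w → xy ≡ (z ℤ.* + 5 , w ℤ.* + 5) × n ≡ norm (z , w) * 5
  ∈-multiples⁻ {n} xy∈ with ∈-map⁻ _ xy∈
  ... | (z , w) , zw∈ , refl with ∈-pairs⁻ dilatedRoots dilatedRoots n zw∈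
  ... | i , j , refl , z∈ , w∈ = z , w , refl ,
    trans (cong₂ _+_ (∈-dilatedRoots⁻ {i} z∈) (∈-dilatedRoots⁻ {j} w∈)) (sym (ℕ.*-distribʳ-+ 5 (sq z) (sq w)))

  norm-multiple : ∀ z w → norm (z ℤ.* + 5 , w ℤ.* + 5) ≡ norm (z , w) * 5 * 5
  norm-multiple z w = begin
    sq (z ℤ.* + 5) + sq (w ℤ.* + 5)   ≡⟨ cong₂ _+_ (sq-* z (+ 5)) (sq-* w (+ 5)) ⟩
    sq z * 25 + sq w * 25             ≡⟨ ℕ.*-distribʳ-+ 25 (sq z) (sq w) ⟨
    norm (z , w) * 25                 ≡⟨ ℕ.*-assoc (norm (z , w)) 5 5 ⟨
    norm (z , w) * 5 * 5              ∎

  unit-orient : ∀ {x y j} → sq x ≡ j * 5 + 1 → orient (x , y) ≡ (x , y)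
  unit-orient {x} {y} {j} eq = orient-keep {x} {y} λ ≡4 →
    1≢4 (trans (sym (residue 4 j 1 (s≤s (s≤s z≤n)))) (trans (cong (_% 5) (sym eq)) ≡4))
    where
    1≢4 : 1 ≢ 4
    1≢4 ()

  nonresidue-orient : ∀ {x y j} → sq x ≡ j * 5 + 4 → orient (x , y) ≡ (y , x)
  nonresidue-orient {x} {y} {j} eq =
    orient-swap {x} {y} (trans (cong (_% 5) eq) (residue 4 j 4 ℕ.≤-refl))

  module _ where
    open ℕS.+-*-Solver

    sum-1-4 : ∀ j j′ → (j * 5 + 1) + (j′ * 5 + 4) ≡ (suc j + j′) * 5
    sum-1-4 = solve 2 (λ j j′ → (j :* con 5 :+ con 1) :+ (j′ :* con 5 :+ con 4) := (con 1 :+ j :+ j′) :* con 5) refl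

  norm-units : ∀ {x y j j′ n} → sq x ≡ j * 5 + 1 → sq y ≡ j′ * 5 + 4 → n ≡ suc j + j′ → norm (x , y) ≡ n * 5
  norm-units {j = j} {j′} x≡ y≡ refl = trans (cong₂ _+_ x≡ y≡) (sum-1-4 j j′)

  residue-sum : ∀ {a b n} r s → a % 5 ≡ r → b % 5 ≡ s → a + b ≡ n * 5 → (r + s) % 5 ≡ 0
  residue-sum {a} {b} {n} r s refl refl eq =
    trans (sym (%-distribˡ-+ a b 5)) (trans (cong (_% 5) eq) (m*n%n≡0 n 5))

  complement-1 : ∀ {x y j n} → sq x ≡ j * 5 + 1 → norm (x , y) ≡ n * 5 →
                 ∃ λ j′ → sq y ≡ j′ * 5 + 4 × n ≡ suc j + j′
  complement-1 {x} {y} {j} {n} x≡ norm≡ with square-mod-5 (∣ y ∣)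
  ... | inj₂ (inj₂ (j′ , y≡)) =
    j′ , y≡ , ℕ.*-cancelʳ-≡ n (suc j + j′) 5 (trans (sym norm≡) (norm-units {x} {y} {j} {j′} x≡ y≡ refl))
  ... | inj₂ (inj₁ (j′ , y≡)) with () ← residue-sum {sq x} {sq y} {n} 1 1
          (trans (cong (_% 5) x≡) (residue 4 j 1 (s≤s (s≤s z≤n))))
          (trans (cong (_% 5) y≡) (residue 4 j′ 1 (s≤s (s≤s z≤n)))) norm≡
  ... | inj₁ (i , y≡) with () ← residue-sum {sq x} {sq y} {n} 1 0
          (trans (cong (_% 5) x≡) (residue 4 j 1 (s≤s (s≤s z≤n))))
          (multiple-sq%5 {y} {i} y≡) norm≡

  complement-4 : ∀ {x y j n} → sq x ≡ j * 5 + 4 → norm (x , y) ≡ n * 5 →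
                 ∃ λ j′ → sq y ≡ j′ * 5 + 1 × n ≡ suc j′ + j
  complement-4 {x} {y} {j} {n} x≡ norm≡ with square-mod-5 (∣ y ∣)
  ... | inj₂ (inj₁ (j′ , y≡)) =
    j′ , y≡ , ℕ.*-cancelʳ-≡ n (suc j′ + j) 5 (trans (sym norm≡)
      (trans (ℕ.+-comm (sq x) (sq y)) (norm-units {y} {x} {j′} {j} y≡ x≡ refl)))
  ... | inj₂ (inj₂ (j′ , y≡)) with () ← residue-sum {sq x} {sq y} {n} 4 4
          (trans (cong (_% 5) x≡) (residue 4 j 4 ℕ.≤-refl))
          (trans (cong (_% 5) y≡) (residue 4 j′ 4 ℕ.≤-refl)) norm≡
  ... | inj₁ (i , y≡) with () ← residue-sum {sq x} {sq y} {n} 4 0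
          (trans (cong (_% 5) x≡) (residue 4 j 4 ℕ.≤-refl))
          (multiple-sq%5 {y} {i} y≡) norm≡

  -- Coefficient n of the formula for θ². `fold` is injective on the pairs of norm n, and its image
  -- consists of the pairs of norm 5n with both entries divisible by 5 (`multiples`) or with squares
  -- 1 and 4 mod 5 in this order (`units`).
  length-pairs-roots : ∀ n → length (pairs roots roots n) ≡
    length (pairs dilatedRoots dilatedRoots n) + length (pairs roots₁ roots₄ n)
  length-pairs-roots n = begin
    length (pairs roots roots n)
      ≡⟨ length-map fold (pairs roots roots n) ⟨
    length (map fold (pairs roots roots n))
      ≡⟨ unique-length
           (map⁺ (λ {p} {q} → fold-injective {p} {q})
             (pairs-unique roots roots roots-unique roots-unique
               (λ x∈ x∈′ → trans (sym (∈-roots⁻ x∈)) (∈-roots⁻ x∈′)) n))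
           (++⁺ multiples-unique units-unique disjoint)
           to from ⟩
    length (multiples ++ units)
      ≡⟨ length-++ multiples ⟩
    length multiples + length units
      ≡⟨ cong (_+ length units) (length-map _ (pairs dilatedRoots dilatedRoots n)) ⟩
    length (pairs dilatedRoots dilatedRoots n) + length units ∎
    where
    multiples units : List (ℤ × ℤ)
    multiples = map (λ (z , w) → z ℤ.* + 5 , w ℤ.* + 5) (pairs dilatedRoots dilatedRoots n)
    units = pairs roots₁ roots₄ n

    multiples-unique : Unique multiples
    multiples-unique = map⁺
      (λ eq → cong₂ _,_ (ℤ.*-cancelʳ-≡ _ _ (+ 5) (cong proj₁ eq)) (ℤ.*-cancelʳ-≡ _ _ (+ 5) (cong proj₂ eq)))
      (pairs-unique dilatedRoots dilatedRoots
        (spread-unique 4 0 roots roots-unique) (spread-unique 4 0 roots roots-unique)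
        (λ {i} {j} z∈ z∈′ → trans (∈-dilatedRoots⁻ {i} z∈) (sym (∈-dilatedRoots⁻ {j} z∈′))) n)

    units-unique : Unique units
    units-unique = pairs-unique roots₁ roots₄
      (delay-unique 1 (section 4 1 roots) (λ m → roots-unique (m * 5 + 1))) (λ m → roots-unique (m * 5 + 4))
      same n
      where
      same : Disjoint-family roots₁
      same {i} {i′} x∈ x∈′ with ∈-roots₁⁻ {i} x∈ | ∈-roots₁⁻ {i′} x∈′
      ... | j , refl , eq | j′ , refl , eq′ =
        cong suc (ℕ.*-cancelʳ-≡ j j′ 5 (ℕ.+-cancelʳ-≡ 1 _ _ (trans (sym eq) eq′)))

    disjoint : ∀ {xy} → ¬ (xy ∈ multiples × xy ∈ units)
    disjoint (p , q) with ∈-multiples⁻ {n} p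
    ... | z , w , refl , _ with ∈-pairs⁻ roots₁ roots₄ n q
    ... | i , _ , _ , x∈ , _ with ∈-roots₁⁻ {i} x∈
    ... | j , refl , eq with () ← trans (sym (divisible⇒sq%5 {z = z} refl))
                                    (trans (cong (_% 5) eq) (residue 4 j 1 (s≤s (s≤s z≤n))))

    preimage : ∀ p {xy} → norm (rotate p) ≡ n * 5 → fold p ≡ xy → xy ∈ map fold (pairs roots roots n)
    preimage p@(u , v) norm≡ refl = ∈-map⁺ fold
      (subst (λ m → p ∈ pairs roots roots m)
        (ℕ.*-cancelʳ-≡ (norm p) n 5 (trans (sym (norm-rotate p)) norm≡))
        (∈-pairs⁺ roots roots (sq u) (sq v) (∈-roots⁺ u refl) (∈-roots⁺ v refl)))

    from : ∀ {xy} → xy ∈ multiples ++ units → xy ∈ map fold (pairs roots roots n)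
    from xy∈ with ∈-++⁻ multiples xy∈
    from xy∈ | inj₁ xy∈′ with ∈-multiples⁻ {n} xy∈′
    ... | z , w , refl , n≡ = preimage (+ 2 ℤ.* z ℤ.+ w , + 2 ℤ.* w ℤ.- z)
      (trans (cong norm (rotate-hits-multiple z w)) (trans (norm-multiple z w) (cong (_* 5) (sym n≡))))
      (trans (cong orient (rotate-hits-multiple z w)) (divisible-orient {z = z} refl))
    from {x , y} xy∈ | inj₂ xy∈′ with ∈-pairs⁻ roots₁ roots₄ n xy∈′
    ... | i , j′ , n≡ , x∈ , y∈ with ∈-roots₁⁻ {i} x∈
    ... | j , refl , x≡ with split-mod-5 x y {j} {j′} x≡ (∈-roots⁻ y∈)
    ...   | inj₁ (k , eq) = preimage (k , + 2 ℤ.* k ℤ.- x)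
      (trans (cong norm (rotate-hits {x} {y} {k} eq)) (norm-units {x} {y} {j} {j′} x≡ (∈-roots⁻ y∈) n≡))
      (trans (cong orient (rotate-hits {x} {y} {k} eq)) (unit-orient {x} {y} {j} x≡))
    -- In this case (y, x) is the multiple of 2 + i. As y² = 4 mod 5, `orient` swaps it back to (x,
    -- y).
    ...   | inj₂ (k , eq) = preimage (x ℤ.- + 2 ℤ.* k , k)
      (trans (cong norm (rotate-hits-swapped {x} {y} {k} eq))
        (trans (ℕ.+-comm (sq y) (sq x)) (norm-units {x} {y} {j} {j′} x≡ (∈-roots⁻ y∈) n≡)))
      (trans (cong orient (rotate-hits-swapped {x} {y} {k} eq)) (nonresidue-orient {y} {x} {j′} (∈-roots⁻ y∈)))

    ∈-units : ∀ {x y} j j′ → sq x ≡ j * 5 + 1 → sq y ≡ j′ * 5 + 4 → n ≡ suc j + j′ → (x , y) ∈ units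
    ∈-units {x} {y} j j′ x≡ y≡ n≡ = subst (λ m → (x , y) ∈ pairs roots₁ roots₄ m) (sym n≡)
      (∈-pairs⁺ roots₁ roots₄ (suc j) j′ (∈-roots₁⁺ {j} x x≡) (∈-roots⁺ y y≡))

    oriented : ∀ p → norm (rotate p) ≡ n * 5 → orient (rotate p) ∈ multiples ++ units
    oriented p norm≡ with square-mod-5 (∣ proj₁ (rotate p) ∣)
    -- Divisibility of x by 5 passes to y, since y = 3x mod 5 on the image of `rotate`.
    ... | inj₁ (i , eq) with abs-multiple {proj₁ (rotate p)} {i} 5 eq
    ... | z , x≡ with rotate-divisible p {z} x≡
    ... | w , y≡ = ∈-++⁺ˡ (subst (_∈ multiples)
      (sym (trans (divisible-orient {z = z} x≡) (cong₂ _,_ x≡ y≡)))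
      (∈-map⁺ _ (subst (λ m → (z , w) ∈ pairs dilatedRoots dilatedRoots m)
        (trans (sym (ℕ.*-distribʳ-+ 5 (sq z) (sq w)))
          (ℕ.*-cancelʳ-≡ (norm (z , w) * 5) n 5
            (trans (sym (norm-multiple z w)) (trans (cong₂ (λ a b → norm (a , b)) (sym x≡) (sym y≡)) norm≡))))
        (∈-pairs⁺ dilatedRoots dilatedRoots (sq z * 5) (sq w * 5) (∈-dilatedRoots⁺ z) (∈-dilatedRoots⁺ w)))))
    oriented p norm≡ | inj₂ (inj₁ (j , x≡)) with complement-1 {proj₁ (rotate p)} {proj₂ (rotate p)} {j} x≡ norm≡
    ... | j′ , y≡ , n≡ = ∈-++⁺ʳ multiples (subst (_∈ units)
      (sym (unit-orient {proj₁ (rotate p)} {proj₂ (rotate p)} {j} x≡)) (∈-units j j′ x≡ y≡ n≡))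
    oriented p norm≡ | inj₂ (inj₂ (j , x≡)) with complement-4 {proj₁ (rotate p)} {proj₂ (rotate p)} {j} x≡ norm≡
    ... | j′ , y≡ , n≡ = ∈-++⁺ʳ multiples (subst (_∈ units)
      (sym (nonresidue-orient {proj₁ (rotate p)} {proj₂ (rotate p)} {j} x≡)) (∈-units j′ j y≡ x≡ n≡))

    to : ∀ {xy} → xy ∈ map fold (pairs roots roots n) → xy ∈ multiples ++ units
    to xy∈ with ∈-map⁻ fold xy∈
    ... | p@(u , v) , p∈ , refl with ∈-pairs⁻ roots roots n p∈
    ... | i , j , n≡ , u∈ , v∈ = oriented p (trans (norm-rotate p)
      (cong (_* 5) (trans (cong₂ _+_ (∈-roots⁻ {i} {u} u∈) (∈-roots⁻ {j} {v} v∈)) (sym n≡))))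

section-roots-% : ∀ m r n {x} → r < suc m → x ∈ section m r roots n → sq x % suc m ≡ r
section-roots-% m r n {x} r< x∈ = trans (cong (_% suc m) (∈-roots⁻ {n * suc m + r} {x} x∈)) (residue m n r r<)

-- A square depends only on its root modulo m + 1, which leaves finitely many residues for a
-- decision procedure to check.
section-roots-empty : ∀ m r → r < suc m → (∀ (i : Fin (suc m)) → (toℕ i * toℕ i) % suc m ≢ r) →
                      ∀ n → length (section m r roots n) ≡ 0
section-roots-empty m r r< nonresidue n = length-empty λ {x} x∈ → nonresidue (fromℕ< (m%n<n (∣ x ∣) (suc m)))
  (trans (cong (λ i → (i * i) % suc m) (toℕ-fromℕ< (m%n<n (∣ x ∣) (suc m))))
    (trans (sym (%-distribˡ-* (∣ x ∣) (∣ x ∣) (suc m))) (section-roots-% m r n {x} r< x∈)))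

length-section-3-0-roots : ∀ n → length (section 3 0 roots n) ≡ length (roots n)
length-section-3-0-roots n = sym (trans (sym (length-map (ℤ._* + 2) (roots n)))
  (unique-length (map⁺ (λ {x} {y} → ℤ.*-cancelʳ-≡ x y (+ 2)) (roots-unique n)) (roots-unique (n * 4 + 0)) to from))
  where
  to : ∀ {x} → x ∈ map (ℤ._* + 2) (roots n) → x ∈ section 3 0 roots n
  to x∈ with ∈-map⁻ (ℤ._* + 2) x∈
  ... | z , z∈ , refl = ∈-roots⁺ (z ℤ.* + 2) (trans (sq-* z (+ 2))
    (trans (cong (_* 4) (∈-roots⁻ {n} {z} z∈)) (sym (ℕ.+-identityʳ _))))

  from : ∀ {x} → x ∈ section 3 0 roots n → x ∈ map (ℤ._* + 2) (roots n)
  from {x} x∈ with square-mod-4 (∣ x ∣)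
  ... | inj₂ (j , eq) with () ← trans (sym (section-roots-% 3 0 n {x} (s≤s z≤n) x∈))
                                  (trans (cong (_% 4) eq) (residue 3 j 1 (s≤s (s≤s z≤n))))
  ... | inj₁ (i , eq) with abs-multiple {x} {i} 2 eq
  ... | z , refl = ∈-map⁺ (ℤ._* + 2) (∈-roots⁺ z (ℕ.*-cancelʳ-≡ (sq z) n 4
    (trans (sym (sq-* z (+ 2))) (trans (∈-roots⁻ {x = z ℤ.* + 2} x∈) (ℕ.+-identityʳ _)))))

-- If 5 divides x² then x = 5z, and x² = 5n becomes 5z² = n. So the class 0 mod 5 of θ is θ(q⁵).
length-section-4-0-roots : ∀ n → length (section 4 0 roots n) ≡ length (dilatedRoots n)
length-section-4-0-roots n = sym (trans (sym (length-map (ℤ._* + 5) (dilatedRoots n)))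
  (unique-length (map⁺ (λ {x} {y} → ℤ.*-cancelʳ-≡ x y (+ 5)) (spread-unique 4 0 roots roots-unique n))
    (roots-unique (n * 5 + 0)) to from))
  where
  to : ∀ {x} → x ∈ map (ℤ._* + 5) (dilatedRoots n) → x ∈ section 4 0 roots n
  to x∈ with ∈-map⁻ (ℤ._* + 5) x∈
  ... | z , z∈ , refl = ∈-roots⁺ (z ℤ.* + 5) (trans (sq-* z (+ 5))
    (trans (sym (ℕ.*-assoc (sq z) 5 5)) (trans (cong (_* 5) (sym (∈-dilatedRoots⁻ {n} {z} z∈)))
      (sym (ℕ.+-identityʳ _)))))

  from : ∀ {x} → x ∈ section 4 0 roots n → x ∈ map (ℤ._* + 5) (dilatedRoots n)
  from {x} x∈ with square-mod-5 (∣ x ∣)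
  ... | inj₂ (inj₁ (j , eq)) with () ← trans (sym (section-roots-% 4 0 n {x} (s≤s z≤n) x∈))
                                  (trans (cong (_% 5) eq) (residue 4 j 1 (s≤s (s≤s z≤n))))
  ... | inj₂ (inj₂ (j , eq)) with () ← trans (sym (section-roots-% 4 0 n {x} (s≤s z≤n) x∈))
                                  (trans (cong (_% 5) eq) (residue 4 j 4 ℕ.≤-refl))
  ... | inj₁ (i , eq) with abs-multiple {x} {i} 5 eq
  ... | z , refl = ∈-map⁺ (ℤ._* + 5) (subst (λ m → z ∈ dilatedRoots m)
    (ℕ.*-cancelʳ-≡ (sq z * 5) n 5 (trans (ℕ.*-assoc (sq z) 5 5) (trans (sym (sq-* z (+ 5)))
      (trans (∈-roots⁻ {x = z ℤ.* + 5} x∈) (ℕ.+-identityʳ _)))))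
    (∈-dilatedRoots⁺ z))

-- Power series modulo 5

infix 4 _≡_⟨mod_⟩

-- Unlike the relation in the theorem, this record does not unfold to divisibility of absolute
-- values, so `a` and `b` can be inferred from a congruence. Signed divisibility supplies the
-- closure under sums and multiples.
record _≡_⟨mod_⟩ (a b m : ℤ) : Set where
  constructor cong-mod
  field diff-divisible : m ∣ℤ a ℤ.- b

open _≡_⟨mod_⟩ public

module _ (m : ℤ) where
  open ℤS.+-*-Solver

  private
    reflexive : ∀ {a b} → a ≡ b → a ≡ b ⟨mod m ⟩
    reflexive {a} refl = cong-mod (ℤ∣.divides 0ℤ (ℤ.+-inverseʳ a))

    along : ∀ {a b c} → m ∣ℤ c → c ≡ a ℤ.- b → a ≡ b ⟨mod m ⟩
    along m∣c c≡ = cong-mod (subst (m ∣ℤ_) c≡ m∣c)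

  ℤ/ : CommutativeRing 0ℓ 0ℓ
  ℤ/ = record
    { Carrier = ℤ
    ; _≈_ = _≡_⟨mod m ⟩
    ; _+_ = ℤ._+_
    ; _*_ = ℤ._*_
    ; -_ = ℤ.-_
    ; 0# = 0ℤ
    ; 1# = 1ℤ
    ; isCommutativeRing = record
      { isRing = record
        { +-isAbelianGroup = record
          { isGroup = record
            { isMonoid = record
              { isSemigroup = record
                { isMagma = record
                  { isEquivalence = record
                    { refl = reflexive refl
                    ; sym = λ {a} {b} (cong-mod d) → along (ℤ∣.∣m⇒∣-m d)
                        (solve 2 (λ a b → :- (a :- b) := b :- a) refl a b)
                    ; trans = λ {a} {b} {c} (cong-mod d) (cong-mod e) → along (ℤ∣.∣m∣n⇒∣m+n d e)
                        (solve 3 (λ a b c → (a :- b) :+ (b :- c) := a :- c) refl a b c)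
                    }
                  ; ∙-cong = λ {a} {b} {c} {e} (cong-mod d) (cong-mod d′) → along (ℤ∣.∣m∣n⇒∣m+n d d′)
                      (solve 4 (λ a b c e → (a :- b) :+ (c :- e) := (a :+ c) :- (b :+ e)) refl a b c e)
                  }
                ; assoc = λ a b c → reflexive (ℤ.+-assoc a b c)
                }
              ; identity = (λ a → reflexive (ℤ.+-identityˡ a)) , (λ a → reflexive (ℤ.+-identityʳ a))
              }
            ; inverse = (λ a → reflexive (ℤ.+-inverseˡ a)) , (λ a → reflexive (ℤ.+-inverseʳ a))
            ; ⁻¹-cong = λ {a} {b} (cong-mod d) → along (ℤ∣.∣m⇒∣-m d)
                (solve 2 (λ a b → :- (a :- b) := :- a :- (:- b)) refl a b)
            }
          ; comm = λ a b → reflexive (ℤ.+-comm a b)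
          }
        ; *-cong = λ {a} {b} {c} {e} (cong-mod d) (cong-mod d′) →
            along (ℤ∣.∣m∣n⇒∣m+n (ℤ∣.∣m⇒∣m*n c d) (ℤ∣.∣n⇒∣m*n b d′))
              (solve 4 (λ a b c e → (a :- b) :* c :+ b :* (c :- e) := a :* c :- b :* e) refl a b c e)
        ; *-assoc = λ a b c → reflexive (ℤ.*-assoc a b c)
        ; *-identity = (λ a → reflexive (ℤ.*-identityˡ a)) , (λ a → reflexive (ℤ.*-identityʳ a))
        ; distrib = (λ a b c → reflexive (ℤ.*-distribˡ-+ a b c)) , (λ a b c → reflexive (ℤ.*-distribʳ-+ a b c))
        }
      ; *-comm = λ a b → reflexive (ℤ.*-comm a b)
      }
    }

open PowerSeries (ℤ/ (+ 5))

module ℤ₅ = CommutativeRing (ℤ/ (+ 5))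
module S = CommutativeRing series-commutativeRing

module SeriesSolver where
  private
    coefficients : CommutativeRing.rawRing (ℤ/ (+ 5)) -Raw-AlmostCommutative⟶ fromCommutativeRing series-commutativeRing
    coefficients = record
      { ⟦_⟧ = const
      ; +-homo = const-+
      ; *-homo = const-*
      ; -‿homo = const-neg
      ; 0-homo = S.refl
      ; 1-homo = S.refl
      }

    -- Constants are compared as integers, not modulo 5. Solver identities therefore hold over ℤ and
    -- carry their multiples of 5 as an explicit summand, removed afterwards by `five⊛`.
    coeff≟ : ∀ a b → Maybe (const a ≋ const b)
    coeff≟ a b with a ℤ.≟ b
    ... | yes refl = just S.refl
    ... | no _     = nothing

  open Algebra.Solver.Ring _ _ coefficients coeff≟ public

open SeriesSolver
open import Algebra.Properties.CommutativeSemiring.Exp S.commutativeSemiring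
  using (_^_; ^-congˡ; ^-assocʳ; ^-distrib-*)
open import Relation.Binary.Reasoning.Setoid S.setoid

zeroₛ one two : Series
zeroₛ = const 0ℤ
one = const 1ℤ
two = const (+ 2)

sign : ℕ → Series
sign zero    = one
sign (suc n) = ⊖ sign n

-- Shanks's finite identity

module Shanks
  -- `P k` is Π (1 + qʲ)/(1 - qʲ) over 1 ≤ j ≤ k, `R k` is `P k` / (1 - q^(k+1)), and `A k` is Σ
  -- (-1)ʲ q^(j²) over |j| ≤ k, all given by equations free of division.
  (P R A : ℕ → Series)
  (P-zero : P 0 ≋ one)
  (P-R : ∀ k → R k ≋ P k ⊕ X ^ suc k ⊛ R k)
  (P-suc : ∀ k → P (suc k) ≋ P k ⊕ two ⊛ (X ^ suc k ⊛ R k))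
  (A-zero : A 0 ≋ one)
  (A-suc : ∀ k → A (suc k) ≋ A k ⊕ two ⊛ (sign (suc k) ⊛ X ^ (suc k ℕ.* suc k)))
  where

  private
    P≋ : ∀ k → P k ≋ R k ⊕ ⊖ (X ^ suc k ⊛ R k)
    P≋ k = begin
      P k
        ≈⟨ solve 2 (λ p x → p := p :+ x :+ :- x) S.refl (P k) (X ^ suc k ⊛ R k) ⟩
      P k ⊕ X ^ suc k ⊛ R k ⊕ ⊖ (X ^ suc k ⊛ R k)
        ≈⟨ S.+-congʳ (P-R k) ⟨
      R k ⊕ ⊖ (X ^ suc k ⊛ R k) ∎

    P-suc≋ : ∀ k → P (suc k) ≋ R k ⊕ X ^ suc k ⊛ R k
    P-suc≋ k = begin
      P (suc k)                             ≈⟨ P-suc k ⟩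
      P k ⊕ two ⊛ (X ^ suc k ⊛ R k)         ≈⟨ S.+-congʳ (P≋ k) ⟩
      R k ⊕ ⊖ (X ^ suc k ⊛ R k) ⊕ two ⊛ (X ^ suc k ⊛ R k)
        ≈⟨ solve 2 (λ r x → r :+ :- (x :* r) :+ con (+ 2) :* (x :* r) := r :+ x :* r) S.refl (R k) (X ^ suc k) ⟩
      R k ⊕ X ^ suc k ⊛ R k                 ∎

  -- bracket y m = Σ (−1)ˢ yˢ Qₛ over s ≤ m, where Q₀ = 1 and Qₛ = 2 Pₛ / (1 + qˢ) = 2 Rₛ₋₁;
  -- Shanks's identity is P⊛A.
  bracket : Series → ℕ → Series
  bracket y zero    = one
  bracket y (suc m) = bracket y m ⊕ sign (suc m) ⊛ y ^ suc m ⊛ (two ⊛ R m)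

  -- Compare coefficients of y^(s+1): they agree since (1 - q^(s+1)) Qₛ₊₁ = 2 Pₛ = (1 + qˢ) Qₛ. The
  -- sum telescopes, and only the top power y^(m+1) leaves a remainder.
  bracket-shift : ∀ y m → bracket (X ⊛ y) m ⊕ ⊖ (y ⊛ bracket (X ⊛ y) m) ≋
    (one ⊕ y) ⊛ bracket y m ⊕ two ⊛ (sign (suc m) ⊛ y ^ suc m ⊛ P m)
  bracket-shift y zero = begin
    one ⊕ ⊖ (y ⊛ one)
      ≈⟨ solve 1 (λ y → con 1ℤ :+ :- (y :* con 1ℤ) :=
                        (con 1ℤ :+ y) :* con 1ℤ :+ con (+ 2) :* ((:- con 1ℤ) :* (y :* con 1ℤ) :* con 1ℤ)) S.refl y ⟩
    (one ⊕ y) ⊛ one ⊕ two ⊛ (⊖ one ⊛ (y ⊛ one) ⊛ one)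
      ≈⟨ S.+-congˡ (S.*-congˡ (S.*-congˡ P-zero)) ⟨
    (one ⊕ y) ⊛ one ⊕ two ⊛ (⊖ one ⊛ (y ⊛ one) ⊛ P 0) ∎
  bracket-shift y (suc m) = begin
    B′ ⊕ e ⊛ (X ⊛ y) ^ suc m ⊛ (two ⊛ r) ⊕ ⊖ (y ⊛ (B′ ⊕ e ⊛ (X ⊛ y) ^ suc m ⊛ (two ⊛ r)))
      ≈⟨ S.+-cong new (S.-‿cong (S.*-congˡ new)) ⟩
    B′ ⊕ e ⊛ (x ⊛ z) ⊛ (two ⊛ r) ⊕ ⊖ (y ⊛ (B′ ⊕ e ⊛ (x ⊛ z) ⊛ (two ⊛ r)))
      ≈⟨ solve 6 (λ b y e x z r →
           b :+ e :* (x :* z) :* (con (+ 2) :* r) :+ :- (y :* (b :+ e :* (x :* z) :* (con (+ 2) :* r))) :=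
           b :+ :- (y :* b) :+ (con 1ℤ :+ :- y) :* (e :* (x :* z) :* (con (+ 2) :* r)))
           S.refl B′ y e x z r ⟩
    B′ ⊕ ⊖ (y ⊛ B′) ⊕ (one ⊕ ⊖ y) ⊛ (e ⊛ (x ⊛ z) ⊛ (two ⊛ r))
      ≈⟨ S.+-congʳ (S.trans (bracket-shift y m) (S.+-congˡ (S.*-congˡ (S.*-congˡ (P≋ m))))) ⟩
    (one ⊕ y) ⊛ B ⊕ two ⊛ (e ⊛ z ⊛ (r ⊕ ⊖ (x ⊛ r))) ⊕ (one ⊕ ⊖ y) ⊛ (e ⊛ (x ⊛ z) ⊛ (two ⊛ r))
      ≈⟨ solve 6 (λ b y e x z r →
           (con 1ℤ :+ y) :* b :+ con (+ 2) :* (e :* z :* (r :+ :- (x :* r)))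
             :+ (con 1ℤ :+ :- y) :* (e :* (x :* z) :* (con (+ 2) :* r)) :=
           (con 1ℤ :+ y) :* (b :+ e :* z :* (con (+ 2) :* r))
             :+ con (+ 2) :* ((:- e) :* (y :* z) :* (r :+ x :* r)))
           S.refl B y e x z r ⟩
    (one ⊕ y) ⊛ (B ⊕ e ⊛ z ⊛ (two ⊛ r)) ⊕ two ⊛ (⊖ e ⊛ (y ⊛ z) ⊛ (r ⊕ x ⊛ r))
      ≈⟨ S.+-congˡ (S.*-congˡ (S.*-congˡ (P-suc≋ m))) ⟨
    (one ⊕ y) ⊛ (B ⊕ e ⊛ z ⊛ (two ⊛ r)) ⊕ two ⊛ (⊖ e ⊛ (y ⊛ z) ⊛ P (suc m)) ∎
    where
    B′ = bracket (X ⊛ y) m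
    B = bracket y m
    e = sign (suc m)
    x = X ^ suc m
    z = y ^ suc m
    r = R m
    new : B′ ⊕ e ⊛ (X ⊛ y) ^ suc m ⊛ (two ⊛ r) ≋ B′ ⊕ e ⊛ (x ⊛ z) ⊛ (two ⊛ r)
    new = S.+-congˡ (S.*-congʳ (S.*-congˡ (^-distrib-* X y (suc m))))

  -- Induction on n. With y = q^(n+1), both sides at n + 1 become (1 + y)(Pₙ Aₙ + 2 (-1)^(n+1)
  -- q^((n+1)²) Pₙ) when multiplied by 1 - y: the left by the recursions of P and A, the right by
  -- `bracket-shift` and the induction hypothesis.
  P⊛A : ∀ n → P n ⊛ A n ≋ bracket (X ^ suc n) n
  P⊛A zero    = S.trans (S.*-cong P-zero A-zero) (S.*-identityˡ one)
  -- The factor 1 - y is cancelled here: u and v both solve w = h + q (qⁿ w). The family of unknowns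
  -- has a single member.
  P⊛A (suc n) = ≋-coinduction (X ^ n) (λ _ → u) (λ _ → v)
    (λ _ → h , tt , fixed u≋ , fixed v≋) tt
    where
    y = X ^ suc n
    z = y ^ suc n
    e = sign (suc n)
    r = R n
    B = bracket y n
    B′ = bracket (X ⊛ y) n
    u = P (suc n) ⊛ A (suc n)
    v = bracket (X ⊛ y) (suc n)
    h = (one ⊕ y) ⊛ (B ⊕ two ⊛ (e ⊛ z ⊛ P n))

    fixed : ∀ {w} → w ⊕ ⊖ (y ⊛ w) ≋ h → w ≋ h ⊕ ↑ (X ^ n ⊛ w)
    fixed {w} w≋ = begin
      w                             ≈⟨ solve 2 (λ w x → w := w :+ :- x :+ x) S.refl w (y ⊛ w) ⟩
      w ⊕ ⊖ (y ⊛ w) ⊕ y ⊛ w         ≈⟨ S.+-cong w≋ (S.trans (S.*-assoc X (X ^ n) w) (S.sym (↑≋X⊛ _))) ⟩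
      h ⊕ ↑ (X ^ n ⊛ w)             ∎

    A≋ : A (suc n) ≋ A n ⊕ two ⊛ (e ⊛ z)
    A≋ = S.trans (A-suc n) (S.+-congˡ (S.*-congˡ (S.*-congˡ (S.sym (^-assocʳ X (suc n) (suc n))))))

    u≋ : u ⊕ ⊖ (y ⊛ u) ≋ h
    u≋ = begin
      u ⊕ ⊖ (y ⊛ u)
        ≈⟨ S.+-cong u≋′ (S.-‿cong (S.*-congˡ u≋′)) ⟩
      (r ⊕ y ⊛ r) ⊛ (A n ⊕ two ⊛ (e ⊛ z)) ⊕ ⊖ (y ⊛ ((r ⊕ y ⊛ r) ⊛ (A n ⊕ two ⊛ (e ⊛ z))))
        ≈⟨ solve 5 (λ r y a e z →
             (r :+ y :* r) :* (a :+ con (+ 2) :* (e :* z)) :+ :- (y :* ((r :+ y :* r) :* (a :+ con (+ 2) :* (e :* z)))) :=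
             (con 1ℤ :+ y) :* ((r :+ :- (y :* r)) :* a :+ con (+ 2) :* (e :* z :* (r :+ :- (y :* r)))))
             S.refl r y (A n) e z ⟩
      (one ⊕ y) ⊛ ((r ⊕ ⊖ (y ⊛ r)) ⊛ A n ⊕ two ⊛ (e ⊛ z ⊛ (r ⊕ ⊖ (y ⊛ r))))
        ≈⟨ S.*-congˡ (S.+-cong (S.*-congʳ (P≋ n)) (S.*-congˡ (S.*-congˡ (P≋ n)))) ⟨
      (one ⊕ y) ⊛ (P n ⊛ A n ⊕ two ⊛ (e ⊛ z ⊛ P n))
        ≈⟨ S.*-congˡ (S.+-congʳ (P⊛A n)) ⟩
      h ∎
      where
      u≋′ = S.*-cong (P-suc≋ n) A≋

    v≋ : v ⊕ ⊖ (y ⊛ v) ≋ h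
    v≋ = begin
      v ⊕ ⊖ (y ⊛ v)
        ≈⟨ S.+-cong v≋′ (S.-‿cong (S.*-congˡ v≋′)) ⟩
      B′ ⊕ e ⊛ (y ⊛ z) ⊛ (two ⊛ r) ⊕ ⊖ (y ⊛ (B′ ⊕ e ⊛ (y ⊛ z) ⊛ (two ⊛ r)))
        ≈⟨ solve 5 (λ b y e z r →
             b :+ e :* (y :* z) :* (con (+ 2) :* r) :+ :- (y :* (b :+ e :* (y :* z) :* (con (+ 2) :* r))) :=
             b :+ :- (y :* b) :+ con (+ 2) :* (e :* (y :* z) :* (r :+ :- (y :* r))))
             S.refl B′ y e z r ⟩
      B′ ⊕ ⊖ (y ⊛ B′) ⊕ two ⊛ (e ⊛ (y ⊛ z) ⊛ (r ⊕ ⊖ (y ⊛ r)))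
        ≈⟨ S.+-cong (bracket-shift y n) (S.*-congˡ (S.*-congˡ (S.sym (P≋ n)))) ⟩
      (one ⊕ y) ⊛ B ⊕ two ⊛ (e ⊛ z ⊛ P n) ⊕ two ⊛ (e ⊛ (y ⊛ z) ⊛ P n)
        ≈⟨ solve 5 (λ b y e z p →
             (con 1ℤ :+ y) :* b :+ con (+ 2) :* (e :* z :* p) :+ con (+ 2) :* (e :* (y :* z) :* p) :=
             (con 1ℤ :+ y) :* (b :+ con (+ 2) :* (e :* z :* p)))
             S.refl B y e z (P n) ⟩
      h ∎
      where
      v≋′ : v ≋ B′ ⊕ e ⊛ (y ⊛ z) ⊛ (two ⊛ r)
      v≋′ = S.+-congˡ (S.*-congʳ (S.*-congˡ (^-distrib-* X y (suc n))))

  private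
    bracket-low : ∀ c m → bracket (X ^ c) m ≐[ c ] one
    bracket-low c zero    _ = ℤ₅.refl
    bracket-low c (suc m) {n} n<c = ℤ₅.trans (⊕-coeff _ _ n)
      (ℤ₅.trans (ℤ₅.+-cong (bracket-low c m n<c) (ℤ₅.trans (factor .coeff n) (X^-⊛-low c _ n<c)))
        (ℤ₅.+-identityʳ _))
      where
      factor : sign (suc m) ⊛ (X ^ c) ^ suc m ⊛ (two ⊛ R m) ≋
               X ^ c ⊛ (sign (suc m) ⊛ (X ^ c) ^ m ⊛ (two ⊛ R m))
      factor = solve 4 (λ e y z r → e :* (y :* z) :* r := y :* (e :* z :* r)) S.refl
        (sign (suc m)) (X ^ c) ((X ^ c) ^ m) (two ⊛ R m)

  -- Every term of the bracket except the leading 1 is divisible by q^(n+1). Coefficient n of the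
  -- product may thus be computed from the truncations at n, where it is that of 1.
  limit-inverse : ∀ p a → (∀ k → p ≐[ suc k ] P k) → (∀ k → a ≐[ suc k ] A k) → p ⊛ a ≋ one
  limit-inverse p a p≐ a≐ .coeff n = ℤ₅.trans (⊛-cong-upTo {suc n} (p≐ n) (a≐ n) ℕ.≤-refl)
    (ℤ₅.trans (P⊛A n .coeff n) (bracket-low (suc n) n ℕ.≤-refl))

-- Generating functions modulo 5

cast : (ℕ → ℕ) → Series
cast f n = + f n

card : ∀ {a} {A : Set a} → (ℕ → List A) → Series
card F = cast (length ∘ F)

cast-cong : ∀ {f g} → (∀ n → f n ≡ g n) → cast f ≋ cast g
cast-cong f≡g .coeff n = ℤ₅.reflexive (cong +_ (f≡g n))

cast-+ : ∀ f g → cast (λ n → f n ℕ.+ g n) ≋ cast f ⊕ cast g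
cast-+ f g .coeff n = ℤ₅.trans (ℤ₅.reflexive (ℤ.pos-+ (f n) (g n))) (ℤ₅.sym (⊕-coeff _ _ n))

cast-delay : ∀ c f → cast (delay 0 c f) ≋ X ^ c ⊛ cast f
cast-delay c f = S.trans (coeffs λ n → ℤ₅.reflexive (delay-map +_ 0 c f n)) (delay≋X^⊛ c (cast f))

card-pairs : ∀ {a b} {A : Set a} {B : Set b} (F : ℕ → List A) (G : ℕ → List B) →
             card (pairs F G) ≋ card F ⊛ card G
card-pairs F G = coeffs λ n → ℤ₅.reflexive (go F G n)
  where
  product : ∀ {a b} {A : Set a} {B : Set b} (xs : List A) (ys : List B) →
            + length (cartesianProduct xs ys) ≡ + length xs ℤ.* + length ys
  product xs ys = trans (cong +_ (length-cartesianProduct xs ys)) (ℤ.pos-* (length xs) (length ys))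

  go : ∀ {a b} {A : Set a} {B : Set b} (F : ℕ → List A) (G : ℕ → List B) n →
       + length (pairs F G n) ≡ (card F ⊛ card G) n
  go F G zero    = product (F 0) (G 0)
  go F G (suc n) = trans (cong +_ (length-++ (cartesianProduct (F 0) (G (suc n)))))
    (trans (ℤ.pos-+ (length (cartesianProduct (F 0) (G (suc n)))) (length (pairs (F ∘ suc) G n)))
      (cong₂ ℤ._+_ (product (F 0) (G (suc n))) (go (F ∘ suc) G n)))

sign-double : ∀ m n → sign (m ℕ.+ (n ℕ.+ n)) ≋ sign m
sign-double m zero    = S.reflexive (cong sign (ℕ.+-identityʳ m))
sign-double m (suc n) = begin
  sign (m ℕ.+ suc (n ℕ.+ suc n))
    ≡⟨ cong sign (trans (ℕ.+-suc m (n ℕ.+ suc n)) (cong suc (trans (cong (m ℕ.+_) (ℕ.+-suc n n)) (ℕ.+-suc m (n ℕ.+ n))))) ⟩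
  ⊖ ⊖ sign (m ℕ.+ (n ℕ.+ n))
    ≈⟨ solve 1 (λ s → :- :- s := s) S.refl _ ⟩
  sign (m ℕ.+ (n ℕ.+ n))
    ≈⟨ sign-double m n ⟩
  sign m ∎

-- Under q ↦ -q the term q^(n²) acquires (-1)^(n²), whereas Shanks's sum is written with (-1)ⁿ; n²
-- and n have the same parity.
sign-square : ∀ n → sign (n ℕ.* n) ≋ sign n
sign-square zero    = S.refl
sign-square (suc n) = begin
  ⊖ sign (n ℕ.+ n ℕ.* suc n)
    ≡⟨ cong (⊖_ ∘ sign) (trans (cong (n ℕ.+_) (ℕ.*-suc n n)) (trans (sym (ℕ.+-assoc n n (n ℕ.* n))) (ℕ.+-comm (n ℕ.+ n) (n ℕ.* n)))) ⟩
  ⊖ sign (n ℕ.* n ℕ.+ (n ℕ.+ n))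
    ≈⟨ S.-‿cong (S.trans (sign-double (n ℕ.* n) n) (sign-square n)) ⟩
  ⊖ sign n ∎

alternate-X : alternate X ≋ ⊖ X
alternate-X .coeff n = ℤ₅.trans (go n) (ℤ₅.sym (⊖-coeff X n))
  where
  go : ∀ n → alternate X n ℤ₅.≈ ℤ₅.- X n
  go zero          = ℤ₅.refl
  go (suc n)       = ℤ₅.-‿cong (alternate-const 1ℤ .coeff n)

alternate-X^ : ∀ n → alternate (X ^ n) ≋ sign n ⊛ X ^ n
alternate-X^ zero    = S.trans (alternate-const 1ℤ) (S.sym (S.*-identityˡ one))
alternate-X^ (suc n) = begin
  alternate (X ⊛ X ^ n)             ≈⟨ alternate-⊛ X (X ^ n) ⟩
  alternate X ⊛ alternate (X ^ n)   ≈⟨ S.*-cong alternate-X (alternate-X^ n) ⟩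
  ⊖ X ⊛ (sign n ⊛ X ^ n)            ≈⟨ solve 3 (λ x s y → (:- x) :* (s :* y) := (:- s) :* (x :* y)) S.refl X (sign n) (X ^ n) ⟩
  ⊖ sign n ⊛ (X ⊛ X ^ n)            ∎

θ : Series
θ = card roots

double : ∀ f → f ⊕ f ≋ two ⊛ f
double = solve 1 (λ f → f :+ f := con (+ 2) :* f) S.refl

overpartitions-inverse : cast p̅ ⊛ alternate θ ≋ one
overpartitions-inverse = limit-inverse (cast p̅) (alternate θ)
  (λ k n<k → ℤ₅.reflexive (cong +_ (p̅-atMost (ℕ.≤-pred n<k))))
  (λ k → truncate k)
  where
  P R A : ℕ → Series
  P k = card (atMost k)
  R k = card (after (suc k))
  A k = alternate (card (rootsUpTo k))

  truncate : ∀ k {n} → n < suc k → alternate θ n ℤ₅.≈ A k n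
  truncate k {n} (s≤s n≤k) = go n (λ {i} i≤n → cong +_ (length-roots (ℕ.≤-trans i≤n n≤k)))
    where
    go : ∀ n {f g : Series} → (∀ {i} → i ≤ n → f i ≡ g i) → alternate f n ℤ₅.≈ alternate g n
    go zero    f≡g = ℤ₅.reflexive (f≡g z≤n)
    go (suc n) f≡g = ℤ₅.-‿cong (go n (λ i≤n → f≡g (s≤s i≤n)))

  P-zero : P 0 ≋ one
  P-zero .coeff zero    = ℤ₅.refl
  P-zero .coeff (suc n) = ℤ₅.reflexive (cong +_ (length-atMost-zero n))

  P-R : ∀ k → R k ≋ P k ⊕ X ^ suc k ⊛ R k
  P-R k = begin
    R k ≈⟨ cast-cong (length-after k) ⟩
    _   ≈⟨ cast-+ _ _ ⟩
    _   ≈⟨ S.+-congˡ (cast-delay (suc k) (length ∘ after (suc k))) ⟩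
    P k ⊕ X ^ suc k ⊛ R k ∎

  P-suc : ∀ k → P (suc k) ≋ P k ⊕ two ⊛ (X ^ suc k ⊛ R k)
  P-suc k = begin
    P (suc k) ≈⟨ cast-cong (length-atMost k) ⟩
    _         ≈⟨ cast-+ _ _ ⟩
    _         ≈⟨ S.+-congˡ (S.trans (cast-+ _ _) (double _)) ⟩
    _         ≈⟨ S.+-congˡ (S.*-congˡ (cast-delay (suc k) (length ∘ after (suc k)))) ⟩
    P k ⊕ two ⊛ (X ^ suc k ⊛ R k) ∎

  cast-indicator : ∀ c → cast (indicator c) ≋ X ^ c
  cast-indicator c = S.trans (cast-delay c unit) (S.trans (S.*-congˡ cast-unit) (S.*-identityʳ (X ^ c)))
    where
    cast-unit : cast unit ≋ one
    cast-unit .coeff zero    = ℤ₅.refl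
    cast-unit .coeff (suc _) = ℤ₅.refl

  A-zero : A 0 ≋ one
  A-zero = S.trans (alternate-cong (S.trans (cast-cong length-rootsUpTo-zero) (cast-indicator 0))) (alternate-const 1ℤ)

  A-suc : ∀ k → A (suc k) ≋ A k ⊕ two ⊛ (sign (suc k) ⊛ X ^ (suc k ℕ.* suc k))
  A-suc k = begin
    A (suc k)
      ≈⟨ alternate-cong (S.trans (cast-cong (length-rootsUpTo-suc k)) (S.trans (cast-+ _ _)
           (S.+-congˡ (S.trans (cast-+ _ _) (S.+-cong (cast-indicator c) (cast-indicator c)))))) ⟩
    alternate (card (rootsUpTo k) ⊕ (X ^ c ⊕ X ^ c))
      ≈⟨ S.trans (alternate-⊕ _ _) (S.+-congˡ (alternate-⊕ _ _)) ⟩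
    A k ⊕ (alternate (X ^ c) ⊕ alternate (X ^ c))
      ≈⟨ S.+-congˡ (double _) ⟩
    A k ⊕ two ⊛ alternate (X ^ c)
      ≈⟨ S.+-congˡ (S.*-congˡ (S.trans (alternate-X^ c) (S.*-congʳ (sign-square (suc k))))) ⟩
    A k ⊕ two ⊛ (sign (suc k) ⊛ X ^ c) ∎
    where
    c = suc k ℕ.* suc k

  open Shanks P R A P-zero P-R P-suc A-zero A-suc using (limit-inverse)

-- Sections of θ and its powers

θ-dilated θ₁ θ₄ : Series
θ-dilated = dilate 4 θ
θ₁ = section 4 1 θ
θ₄ = section 4 4 θ

card-dilatedRoots : card dilatedRoots ≋ θ-dilated
card-dilatedRoots .coeff n = ℤ₅.reflexive (spread-map (λ xs → + length xs) [] 4 0 roots n)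

θ² : θ ⊛ θ ≋ θ-dilated ⊛ θ-dilated ⊕ X ⊛ (θ₁ ⊛ θ₄)
θ² = begin
  θ ⊛ θ
    ≈⟨ card-pairs roots roots ⟨
  card (pairs roots roots)
    ≈⟨ S.trans (cast-cong length-pairs-roots) (cast-+ _ _) ⟩
  card (pairs dilatedRoots dilatedRoots) ⊕ card (pairs roots₁ roots₄)
    ≈⟨ S.+-cong (card-pairs dilatedRoots dilatedRoots) (card-pairs roots₁ roots₄) ⟩
  card dilatedRoots ⊛ card dilatedRoots ⊕ card roots₁ ⊛ θ₄
    ≈⟨ S.+-cong (S.*-cong card-dilatedRoots card-dilatedRoots) (S.*-congʳ card-roots₁) ⟩
  θ-dilated ⊛ θ-dilated ⊕ X ⊛ θ₁ ⊛ θ₄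
    ≈⟨ S.+-congˡ (S.*-assoc X θ₁ θ₄) ⟩
  θ-dilated ⊛ θ-dilated ⊕ X ⊛ (θ₁ ⊛ θ₄) ∎
  where
  card-roots₁ : card roots₁ ≋ X ⊛ θ₁
  card-roots₁ = S.trans (coeffs λ { zero → ℤ₅.refl ; (suc n) → ℤ₅.refl }) (↑≋X⊛ θ₁)

section-4-0-θ : section 4 0 θ ≋ θ-dilated
section-4-0-θ = S.trans (cast-cong length-section-4-0-roots) card-dilatedRoots

sparse-5 : ∀ f → (∀ n → section 4 2 f n ≡ 0ℤ) → (∀ n → section 4 3 f n ≡ 0ℤ) →
  f ≋ spread 0ℤ 4 0 (section 4 0 f) ⊕ spread 0ℤ 4 1 (section 4 1 f) ⊕ spread 0ℤ 4 4 (section 4 4 f)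
sparse-5 f f₂ f₃ = coeffs λ n →
  ℤ₅.trans (ℤ₅.reflexive (go f f₂ f₃ n)) (ℤ₅.sym (ℤ₅.trans (⊕-coeff _ _ n)
    (ℤ₅.+-congʳ {x = spread 0ℤ 4 4 (section 4 4 f) n} (⊕-coeff _ _ n))))
  where
  go : ∀ f → (∀ n → section 4 2 f n ≡ 0ℤ) → (∀ n → section 4 3 f n ≡ 0ℤ) → ∀ n →
    f n ≡ spread 0ℤ 4 0 (section 4 0 f) n ℤ.+ spread 0ℤ 4 1 (section 4 1 f) n ℤ.+ spread 0ℤ 4 4 (section 4 4 f) n
  go f f₂ f₃ 0 = sym (trans (ℤ.+-identityʳ _) (ℤ.+-identityʳ _))
  go f f₂ f₃ 1 = sym (trans (ℤ.+-identityʳ _) (ℤ.+-identityˡ _))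
  go f f₂ f₃ 2 = f₂ 0
  go f f₂ f₃ 3 = f₃ 0
  go f f₂ f₃ 4 = sym (ℤ.+-identityˡ _)
  -- Five steps return every `spread` to the start of a block, with its series advanced by one
  -- coefficient.
  go f f₂ f₃ (suc (suc (suc (suc (suc n))))) = go (λ i → f (5 ℕ.+ i)) (f₂ ∘ suc) (f₃ ∘ suc) n

sparse-4 : ∀ f → (∀ n → section 3 2 f n ≡ 0ℤ) → (∀ n → section 3 3 f n ≡ 0ℤ) →
  f ≋ spread 0ℤ 3 0 (section 3 0 f) ⊕ spread 0ℤ 3 1 (section 3 1 f)
sparse-4 f f₂ f₃ = coeffs λ n → ℤ₅.trans (ℤ₅.reflexive (go f f₂ f₃ n)) (ℤ₅.sym (⊕-coeff _ _ n))
  where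
  go : ∀ f → (∀ n → section 3 2 f n ≡ 0ℤ) → (∀ n → section 3 3 f n ≡ 0ℤ) → ∀ n →
    f n ≡ spread 0ℤ 3 0 (section 3 0 f) n ℤ.+ spread 0ℤ 3 1 (section 3 1 f) n
  go f f₂ f₃ 0 = sym (ℤ.+-identityʳ _)
  go f f₂ f₃ 1 = sym (ℤ.+-identityˡ _)
  go f f₂ f₃ 2 = f₂ 0
  go f f₂ f₃ 3 = f₃ 0
  go f f₂ f₃ (suc (suc (suc (suc n)))) = go (λ i → f (4 ℕ.+ i)) (f₂ ∘ suc) (f₃ ∘ suc) n

section-4-2-θ : ∀ n → section 4 2 θ n ≡ 0ℤ
section-4-2-θ n = cong +_ (section-roots-empty 4 2 (from-yes (2 ℕ.<? 5))
  (from-yes (all? {n = 5} λ i → ¬? ((toℕ i * toℕ i) % 5 ℕ.≟ 2))) n)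

section-4-3-θ : ∀ n → section 4 3 θ n ≡ 0ℤ
section-4-3-θ n = cong +_ (section-roots-empty 4 3 (from-yes (3 ℕ.<? 5))
  (from-yes (all? {n = 5} λ i → ¬? ((toℕ i * toℕ i) % 5 ℕ.≟ 3))) n)

section-3-2-θ : ∀ n → section 3 2 θ n ≡ 0ℤ
section-3-2-θ n = cong +_ (section-roots-empty 3 2 (from-yes (2 ℕ.<? 4))
  (from-yes (all? {n = 4} λ i → ¬? ((toℕ i * toℕ i) % 4 ℕ.≟ 2))) n)

section-3-3-θ : ∀ n → section 3 3 θ n ≡ 0ℤ
section-3-3-θ n = cong +_ (section-roots-empty 3 3 (from-yes (3 ℕ.<? 4))
  (from-yes (all? {n = 4} λ i → ¬? ((toℕ i * toℕ i) % 4 ℕ.≟ 3))) n)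

section-4-θ-⊛ : ∀ r g → r ≤ 4 → section 4 r (θ ⊛ g) ≋
  θ-dilated ⊛ section 4 r g ⊕ θ₁ ⊛ section 4 r (delay 0ℤ 1 g) ⊕ θ₄ ⊛ section 4 r (delay 0ℤ 4 g)
section-4-θ-⊛ r g r≤4 = begin
  section 4 r (θ ⊛ g)
    ≈⟨ section-cong 4 r (S.trans (S.*-congʳ (sparse-5 θ section-4-2-θ section-4-3-θ))
         (S.trans (S.distribʳ g _ _) (S.+-congʳ (S.distribʳ g _ _)))) ⟩
  section 4 r (spread 0ℤ 4 0 (section 4 0 θ) ⊛ g ⊕ spread 0ℤ 4 1 θ₁ ⊛ g ⊕ spread 0ℤ 4 4 θ₄ ⊛ g)
    ≈⟨ S.trans (section-⊕ 4 r _ _) (S.+-congʳ (section-⊕ 4 r _ _)) ⟩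
  section 4 r (spread 0ℤ 4 0 (section 4 0 θ) ⊛ g) ⊕ section 4 r (spread 0ℤ 4 1 θ₁ ⊛ g) ⊕ section 4 r (spread 0ℤ 4 4 θ₄ ⊛ g)
    ≈⟨ S.+-cong (S.+-cong (section-spread-⊛ 4 0 (section 4 0 θ) g r≤4) (section-spread-⊛ 4 1 θ₁ g r≤4))
         (section-spread-⊛ 4 4 θ₄ g r≤4) ⟩
  section 4 0 θ ⊛ section 4 r g ⊕ θ₁ ⊛ section 4 r (delay 0ℤ 1 g) ⊕ θ₄ ⊛ section 4 r (delay 0ℤ 4 g)
    ≈⟨ S.+-congʳ (S.+-congʳ (S.*-congʳ section-4-0-θ)) ⟩
  θ-dilated ⊛ section 4 r g ⊕ θ₁ ⊛ section 4 r (delay 0ℤ 1 g) ⊕ θ₄ ⊛ section 4 r (delay 0ℤ 4 g) ∎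

record Sections (g g₀ g₁ g₂ g₃ g₄ : Series) : Set where
  field
    s₀ : section 4 0 g ≋ g₀
    s₁ : section 4 1 g ≋ g₁
    s₂ : section 4 2 g ≋ g₂
    s₃ : section 4 3 g ≋ g₃
    s₄ : section 4 4 g ≋ g₄

sections-θ : Sections θ θ-dilated θ₁ zeroₛ zeroₛ θ₄
sections-θ = record
  { s₀ = section-4-0-θ
  ; s₁ = S.refl
  ; s₂ = coeffs λ { zero → ℤ₅.reflexive (section-4-2-θ 0) ; (suc n) → ℤ₅.reflexive (section-4-2-θ (suc n)) }
  ; s₃ = coeffs λ { zero → ℤ₅.reflexive (section-4-3-θ 0) ; (suc n) → ℤ₅.reflexive (section-4-3-θ (suc n)) }
  ; s₄ = S.refl
  }

-- Class r of θ g collects the classes 0, 1, 4 of θ times the classes r, r - 1, r + 1 of g. A factor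
-- `X` appears whenever the two residues add up to r + 5.
sections-θ-⊛ : ∀ {g g₀ g₁ g₂ g₃ g₄} → Sections g g₀ g₁ g₂ g₃ g₄ → Sections (θ ⊛ g)
  (θ-dilated ⊛ g₀ ⊕ θ₁ ⊛ (X ⊛ g₄) ⊕ θ₄ ⊛ (X ⊛ g₁))
  (θ-dilated ⊛ g₁ ⊕ θ₁ ⊛ g₀ ⊕ θ₄ ⊛ (X ⊛ g₂))
  (θ-dilated ⊛ g₂ ⊕ θ₁ ⊛ g₁ ⊕ θ₄ ⊛ (X ⊛ g₃))
  (θ-dilated ⊛ g₃ ⊕ θ₁ ⊛ g₂ ⊕ θ₄ ⊛ (X ⊛ g₄))
  (θ-dilated ⊛ g₄ ⊕ θ₁ ⊛ g₃ ⊕ θ₄ ⊛ g₀)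
sections-θ-⊛ {g} sec = record
  { s₀ = combine 0 z≤n s₀ (wrap 1 0 4 (s≤s z≤n) refl s₄) (wrap 4 0 1 (s≤s z≤n) refl s₁)
  ; s₁ = combine 1 (s≤s z≤n) s₁ (S.trans (section-delay 4 1 0 g) s₀) (wrap 4 1 2 (s≤s (s≤s z≤n)) refl s₂)
  ; s₂ = combine 2 (s≤s (s≤s z≤n)) s₂ (S.trans (section-delay 4 1 1 g) s₁) (wrap 4 2 3 (s≤s (s≤s (s≤s z≤n))) refl s₃)
  ; s₃ = combine 3 (s≤s (s≤s (s≤s z≤n))) s₃ (S.trans (section-delay 4 1 2 g) s₂) (wrap 4 3 4 ℕ.≤-refl refl s₄)
  ; s₄ = combine 4 ℕ.≤-refl s₄ (S.trans (section-delay 4 1 3 g) s₃) (S.trans (section-delay 4 4 0 g) s₀)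
  }
  where
  open Sections sec

  combine : ∀ r {x y z} → r ≤ 4 → section 4 r g ≋ x → section 4 r (delay 0ℤ 1 g) ≋ y → section 4 r (delay 0ℤ 4 g) ≋ z →
            section 4 r (θ ⊛ g) ≋ θ-dilated ⊛ x ⊕ θ₁ ⊛ y ⊕ θ₄ ⊛ z
  combine r r≤4 x y z = S.trans (section-4-θ-⊛ r g r≤4)
    (S.+-cong (S.+-cong (S.*-congˡ x) (S.*-congˡ y)) (S.*-congˡ z))

  wrap : ∀ k r r′ {x} → r < k → k ℕ.+ r′ ≡ 5 ℕ.+ r → section 4 r′ g ≋ x → section 4 r (delay 0ℤ k g) ≋ X ⊛ x
  wrap k r r′ r<k eq x≋ = S.trans (section-delay-wrap 4 k g r<k eq) (S.trans (↑-cong x≋) (↑≋X⊛ _))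

five⊛ : ∀ f → const (+ 5) ⊛ f ≋ zeroₛ
five⊛ f = S.trans (S.*-congʳ (const-cong (cong-mod (ℤ∣.divides 1ℤ refl)))) (S.zeroˡ f)

-- With a = θ(q⁵) and p = q θ₁ θ₄, a product of four terms lands in class 0 only if θ₁ and θ₄ are
-- used equally often. The multinomial coefficients give a⁴ + 12 a²p + 6 p² = (a² + p)² + 5 (2a²p +
-- p²), a square modulo 5.
section-θ⁴ : section 4 0 (θ ⊛ (θ ⊛ (θ ⊛ θ))) ≋ θ ⊛ (θ ⊛ (θ ⊛ θ))
section-θ⁴ = begin
  section 4 0 (θ ⊛ (θ ⊛ (θ ⊛ θ)))
    ≈⟨ Sections.s₀ (sections-θ-⊛ (sections-θ-⊛ (sections-θ-⊛ sections-θ))) ⟩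
  _
    ≈⟨ solve 4 (λ a b c x →
         -- `w₀` to `w₄` are the classes of θ², the `v` those of θ³; `o` stands for the empty
         -- classes 2 and 3 of θ.
         let o  = con 0ℤ
             w₀ = a :* a :+ b :* (x :* c) :+ c :* (x :* b)
             w₁ = a :* b :+ b :* a :+ c :* (x :* o)
             w₂ = a :* o :+ b :* b :+ c :* (x :* o)
             w₃ = a :* o :+ b :* o :+ c :* (x :* c)
             w₄ = a :* c :+ b :* o :+ c :* a
             v₀ = a :* w₀ :+ b :* (x :* w₄) :+ c :* (x :* w₁)
             v₁ = a :* w₁ :+ b :* w₀ :+ c :* (x :* w₂)
             v₄ = a :* w₄ :+ b :* w₃ :+ c :* w₀
             p  = x :* (b :* c)
         in a :* v₀ :+ b :* (x :* v₄) :+ c :* (x :* v₁) :=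
            (a :* a :+ p) :* (a :* a :+ p) :+ con (+ 5) :* (con (+ 2) :* (a :* a :* p) :+ p :* p))
         S.refl θ-dilated θ₁ θ₄ X ⟩
  (θ-dilated ⊛ θ-dilated ⊕ X ⊛ (θ₁ ⊛ θ₄)) ⊛ (θ-dilated ⊛ θ-dilated ⊕ X ⊛ (θ₁ ⊛ θ₄)) ⊕
    const (+ 5) ⊛ (const (+ 2) ⊛ (θ-dilated ⊛ θ-dilated ⊛ (X ⊛ (θ₁ ⊛ θ₄))) ⊕ X ⊛ (θ₁ ⊛ θ₄) ⊛ (X ⊛ (θ₁ ⊛ θ₄)))
    ≈⟨ S.+-cong (S.*-cong (S.sym θ²) (S.sym θ²)) (five⊛ _) ⟩
  θ ⊛ θ ⊛ (θ ⊛ θ) ⊕ zeroₛ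
    ≈⟨ solve 1 (λ t → t :* t :* (t :* t) :+ con 0ℤ := t :* (t :* (t :* t))) S.refl θ ⟩
  θ ⊛ (θ ⊛ (θ ⊛ θ)) ∎

θ-odd : Series
θ-odd = section 3 1 θ

section-3-0-θ : section 3 0 θ ≋ θ
section-3-0-θ = cast-cong length-section-3-0-roots

section-3-θ-⊛ : ∀ r g → r ≤ 3 → section 3 r (θ ⊛ g) ≋ θ ⊛ section 3 r g ⊕ θ-odd ⊛ section 3 r (delay 0ℤ 1 g)
section-3-θ-⊛ r g r≤3 = begin
  section 3 r (θ ⊛ g)
    ≈⟨ section-cong 3 r (S.trans (S.*-congʳ (sparse-4 θ section-3-2-θ section-3-3-θ)) (S.distribʳ g _ _)) ⟩
  section 3 r (spread 0ℤ 3 0 (section 3 0 θ) ⊛ g ⊕ spread 0ℤ 3 1 θ-odd ⊛ g)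
    ≈⟨ section-⊕ 3 r _ _ ⟩
  section 3 r (spread 0ℤ 3 0 (section 3 0 θ) ⊛ g) ⊕ section 3 r (spread 0ℤ 3 1 θ-odd ⊛ g)
    ≈⟨ S.+-cong (section-spread-⊛ 3 0 (section 3 0 θ) g r≤3) (section-spread-⊛ 3 1 θ-odd g r≤3) ⟩
  section 3 0 θ ⊛ section 3 r g ⊕ θ-odd ⊛ section 3 r (delay 0ℤ 1 g)
    ≈⟨ S.+-congʳ (S.*-congʳ section-3-0-θ) ⟩
  θ ⊛ section 3 r g ⊕ θ-odd ⊛ section 3 r (delay 0ℤ 1 g) ∎

-- If one of three squares with sum divisible by 4 is odd, the other two must sum to 3 mod 4. This
-- is impossible, as squares are 0 or 1 mod 4, so only the class 0 of each θ contributes, and that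
-- class is θ again.
section-θ³ : section 3 0 (θ ⊛ (θ ⊛ θ)) ≋ θ ⊛ (θ ⊛ θ)
section-θ³ = begin
  section 3 0 (θ ⊛ (θ ⊛ θ))
    ≈⟨ expand (θ ⊛ θ) ⟩
  θ ⊛ section 3 0 (θ ⊛ θ) ⊕ θ-odd ⊛ (X ⊛ section 3 3 (θ ⊛ θ))
    ≈⟨ S.+-cong (S.*-congˡ (S.trans (expand θ)
         (S.+-cong (S.*-congˡ section-3-0-θ) (S.*-congˡ (S.*-congˡ vanish₃)))))
         (S.*-congˡ (S.*-congˡ (S.trans (section-3-θ-⊛ 3 θ ℕ.≤-refl)
           (S.+-cong (S.*-congˡ vanish₃) (S.*-congˡ (S.trans (section-delay 3 1 2 θ) vanish₂)))))) ⟩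
  θ ⊛ (θ ⊛ θ ⊕ θ-odd ⊛ (X ⊛ zeroₛ)) ⊕ θ-odd ⊛ (X ⊛ (θ ⊛ zeroₛ ⊕ θ-odd ⊛ zeroₛ))
    ≈⟨ solve 3 (λ t d x → t :* (t :* t :+ d :* (x :* con 0ℤ)) :+ d :* (x :* (t :* con 0ℤ :+ d :* con 0ℤ)) := t :* (t :* t))
         S.refl θ θ-odd X ⟩
  θ ⊛ (θ ⊛ θ) ∎
  where
  expand : ∀ g → section 3 0 (θ ⊛ g) ≋ θ ⊛ section 3 0 g ⊕ θ-odd ⊛ (X ⊛ section 3 3 g)
  expand g = S.trans (section-3-θ-⊛ 0 g z≤n)
    (S.+-congˡ (S.*-congˡ (S.trans (section-delay-wrap 3 1 g (s≤s z≤n) refl) (↑≋X⊛ _))))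

  vanish₂ : section 3 2 θ ≋ zeroₛ
  vanish₂ = coeffs λ { zero → ℤ₅.reflexive (section-3-2-θ 0) ; (suc n) → ℤ₅.reflexive (section-3-2-θ (suc n)) }

  vanish₃ : section 3 3 θ ≋ zeroₛ
  vanish₃ = coeffs λ { zero → ℤ₅.reflexive (section-3-3-θ 0) ; (suc n) → ℤ₅.reflexive (section-3-3-θ (suc n)) }

-- Fifth powers modulo 5 and the congruences for overpartitions

const-^ : ∀ x n → const (x ℤ.^ n) ≋ const x ^ n
const-^ x zero    = S.refl
const-^ x (suc n) = S.trans (const-* x (x ℤ.^ n)) (S.*-congˡ (const-^ x n))

-- With f = f₀ + q f′, both sides satisfy u(f) = f₀ + q · q⁴ u(f′). The unknowns are indexed by all
-- series f, so uniqueness applies to the whole family at once.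
frobenius : ∀ f → f ^ 5 ≋ dilate 4 f
frobenius = ≋-coinduction (X ^ 4) (_^ 5) (dilate 4)
  (λ f → const (f 0) , f ∘ suc , power f , dilate-unfold 4 f)
  where
  power : ∀ f → f ^ 5 ≋ const (f 0) ⊕ ↑ (X ^ 4 ⊛ (f ∘ suc) ^ 5)
  power f = begin
    f ^ 5
      ≈⟨ ^-congˡ 5 (S.trans (head-tail f) (S.+-congˡ (↑≋X⊛ f′))) ⟩
    (k ⊕ X ⊛ f′) ^ 5
      -- The mixed binomial coefficients 5, 10, 10, 5 are 5 times 1, 2, 2, 1.
      ≈⟨ solve 3 (λ k x g → (k :+ x :* g) :^ 5 := k :^ 5 :+ x :* (x :^ 4 :* g :^ 5) :+ con (+ 5) :*
           (k :^ 4 :* (x :* g) :+ con (+ 2) :* (k :^ 3 :* (x :* g) :^ 2) :+ con (+ 2) :* (k :^ 2 :* (x :* g) :^ 3) :+ k :* (x :* g) :^ 4))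
           S.refl k X f′ ⟩
    k ^ 5 ⊕ X ⊛ (X ^ 4 ⊛ f′ ^ 5) ⊕ _
      ≈⟨ S.+-cong (S.+-cong constant (S.sym (↑≋X⊛ _))) (five⊛ _) ⟩
    k ⊕ ↑ (X ^ 4 ⊛ f′ ^ 5) ⊕ zeroₛ
      ≈⟨ S.+-identityʳ _ ⟩
    k ⊕ ↑ (X ^ 4 ⊛ f′ ^ 5) ∎
    where
    k = const (f 0)
    f′ = f ∘ suc

    constant : k ^ 5 ≋ k
    constant = S.trans (S.sym (const-^ (f 0) 5)) (const-cong (cong-mod (fermat-5 (f 0))))

alternate-closed : ∀ f n → alternate f n ≡ -1ℤ ℤ.^ n ℤ.* f n
alternate-closed f zero    = sym (ℤ.*-identityˡ (f 0))
alternate-closed f (suc n) = trans (cong ℤ.-_ (alternate-closed (f ∘ suc) n))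
  (trans (ℤ.neg-distribˡ-* (-1ℤ ℤ.^ n) (f (suc n))) (cong (ℤ._* f (suc n)) (sym (ℤ.-1*i≡-i (-1ℤ ℤ.^ n)))))

alternate-involutive : ∀ f → alternate (alternate f) ≋ f
alternate-involutive f = coeffs λ n → ℤ₅.reflexive (trans (alternate-closed (alternate f) n)
  (trans (cong (-1ℤ ℤ.^ n ℤ.*_) (alternate-closed f n)) (trans (sym (ℤ.*-assoc (-1ℤ ℤ.^ n) (-1ℤ ℤ.^ n) (f n)))
    (trans (cong (ℤ._* f n) (sign-involutive n)) (ℤ.*-identityˡ (f n))))))

p± : Series
p± = alternate (cast p̅)

p±-inverse : p± ⊛ θ ≋ one
p±-inverse = begin
  p± ⊛ θ                          ≈⟨ S.*-congˡ (alternate-involutive θ) ⟨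
  p± ⊛ alternate (alternate θ)    ≈⟨ alternate-⊛ (cast p̅) (alternate θ) ⟨
  alternate (cast p̅ ⊛ alternate θ) ≈⟨ alternate-cong overpartitions-inverse ⟩
  alternate one                   ≈⟨ alternate-const 1ℤ ⟩
  one                             ∎

-- θ is cancelled from θ · U(P(-q)) = θ⁴ by multiplying with its inverse, the series `p±` itself.
section-p± : section 4 0 p± ≋ θ ⊛ (θ ⊛ θ)
section-p± = begin
  u                                          ≈⟨ S.*-identityˡ u ⟨
  one ⊛ u                                    ≈⟨ S.*-congʳ p±-inverse ⟨
  p± ⊛ θ ⊛ u                                 ≈⟨ S.*-assoc p± θ u ⟩
  p± ⊛ (θ ⊛ u)                               ≈⟨ S.*-congˡ θ⊛u ⟩
  p± ⊛ (θ ⊛ (θ ⊛ (θ ⊛ θ)))                   ≈⟨ S.*-assoc p± θ _ ⟨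
  p± ⊛ θ ⊛ (θ ⊛ (θ ⊛ θ))                     ≈⟨ S.*-congʳ p±-inverse ⟩
  one ⊛ (θ ⊛ (θ ⊛ θ))                        ≈⟨ S.*-identityˡ _ ⟩
  θ ⊛ (θ ⊛ θ)                                ∎
  where
  u = section 4 0 p±

  θ⊛u : θ ⊛ u ≋ θ ⊛ (θ ⊛ (θ ⊛ θ))
  θ⊛u = begin
    θ ⊛ u                                    ≈⟨ section-spread-⊛ 4 0 θ p± z≤n ⟨
    section 4 0 (dilate 4 θ ⊛ p±)            ≈⟨ section-cong 4 0 (S.*-congʳ (S.sym (frobenius θ))) ⟩
    section 4 0 (θ ^ 5 ⊛ p±)
      ≈⟨ section-cong 4 0 (solve 2 (λ t p → t :^ 5 :* p := p :* t :* (t :* (t :* (t :* t)))) S.refl θ p±) ⟩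
    section 4 0 (p± ⊛ θ ⊛ (θ ⊛ (θ ⊛ (θ ⊛ θ))))
      ≈⟨ section-cong 4 0 (S.trans (S.*-congʳ p±-inverse) (S.*-identityˡ _)) ⟩
    section 4 0 (θ ⊛ (θ ⊛ (θ ⊛ θ)))          ≈⟨ section-θ⁴ ⟩
    θ ⊛ (θ ⊛ (θ ⊛ θ))                        ∎

p±-5n : ∀ n → -1ℤ ℤ.^ n ℤ.* + p̅ (5 * n) ℤ₅.≈ (θ ⊛ (θ ⊛ θ)) n
p±-5n n = ℤ₅.trans (ℤ₅.reflexive (sym (trans (alternate-closed (cast p̅) (n * 5 ℕ.+ 0)) same))) (section-p± .coeff n)
  where
  -- The summand 0 is the residue in `section 4 0`.
  index : n * 5 ℕ.+ 0 ≡ 5 * n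
  index = trans (ℕ.+-identityʳ (n * 5)) (ℕ.*-comm n 5)

  s = -1ℤ ℤ.^ n

  same : -1ℤ ℤ.^ (n * 5 ℕ.+ 0) ℤ.* + p̅ (n * 5 ℕ.+ 0) ≡ s ℤ.* + p̅ (5 * n)
  same = cong₂ (λ e m → e ℤ.* + p̅ m) (trans (cong (-1ℤ ℤ.^_) (ℕ.+-identityʳ (n * 5))) (sign-5n n)) index

theorem1p1 : (n : ℕ) → + p̅ (5 * n) ≡ (-1ℤ ℤ.^ n) ℤ.* (+ p̅ (20 * n)) [mod + 5 ]
theorem1p1 n = ℤ∣.∣⇒∣ᵤ (diff-divisible congruent)
  where
  s = -1ℤ ℤ.^ n

  cancel-sign : ∀ x → s ℤ.* (s ℤ.* x) ≡ x
  cancel-sign x = trans (sym (ℤ.*-assoc s s x)) (trans (cong (ℤ._* x) (sign-involutive n)) (ℤ.*-identityˡ x))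

  -- The formula for multiples of 5 at 4n in place of n: the sign (-1)^(4n) disappears. This is why
  -- the sign in the theorem comes from p̅(5n) alone.
  p-20n : -1ℤ ℤ.^ (n * 4 ℕ.+ 0) ℤ.* + p̅ (5 * (n * 4 ℕ.+ 0)) ≡ + p̅ (20 * n)
  p-20n = trans (cong₂ (λ e m → e ℤ.* + p̅ m)
    (trans (cong (-1ℤ ℤ.^_) (ℕ.+-identityʳ (n * 4))) (sign-4n n))
    (trans (cong (5 *_) (trans (ℕ.+-identityʳ (n * 4)) (ℕ.*-comm n 4))) (sym (ℕ.*-assoc 5 4 n))))
    (ℤ.*-identityˡ (+ p̅ (20 * n)))

  signed : s ℤ.* + p̅ (5 * n) ℤ₅.≈ + p̅ (20 * n)
  signed = ℤ₅.trans (p±-5n n) (ℤ₅.trans (ℤ₅.sym (section-θ³ .coeff n))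
    (ℤ₅.trans (ℤ₅.sym (p±-5n (n * 4 ℕ.+ 0))) (ℤ₅.reflexive p-20n)))

  congruent : + p̅ (5 * n) ℤ₅.≈ s ℤ.* + p̅ (20 * n)
  congruent = ℤ₅.trans (ℤ₅.reflexive (sym (cancel-sign (+ p̅ (5 * n))))) (ℤ₅.*-congˡ {s} signed)
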